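{- Let $q$ be a prime power and let $f_1(x),f_2(x)$ be irreducible polynomials over $\mathbb{F}_q$ of the same degree, with roots $\omega_1,\omega_2$ (in an algebraic closure of $\mathbb{F}_q$) of the same multiplicative order. Then $\mathbb{F}_q[x]/(f_1(x))$ admits an $\eta$-covering if and only if $\mathbb{F}_q[x]/(f_2(x))$ admits an $\eta$-covering.
   Context: For an irreducible polynomial $f$ over $\mathbb{F}_q$ with nonzero root $\omega$, let $\eta:\mathbb{F}_q[x]/(f(x))\to\mathbb{F}_q[x]/(f(x))$ be the $\mathbb{F}_q$-linear map $g(x)+(f(x))\mapsto xg(x)+(f(x))$, whose order $T$ equals the multiplicative order of $\omega$. "$\mathbb{F}_q[x]/(f(x))$ admits an $\eta$-covering" means there is a proper $\mathbb{F}_q$-subspace $U$ with $\bigcup_{i=0}^{T-1}\eta^i(U)=\mathbb{F}_q[x]/(f(x))$. -}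

module Defs where

open import Level using (Level; _⊔_) renaming (suc to lsuc)
open import Data.Nat using (ℕ; zero; suc; _∸_; _≤_; _<_; _^_)
open import Data.Nat.Primality using (Prime)
open import Data.Fin using (Fin; toℕ)
open import Data.Vec using (Vec; []; _∷_; lookup; tabulate; zipWith; map; replicate; last; init)
open import Data.Product using (Σ; ∃; ∃-syntax; _×_; _,_)
open import Data.Sum using (_⊎_)
open import Relation.Nullary using (¬_)
open import Relation.Binary.PropositionalEquality using (_≡_)
open import Algebra.Bundles using (CommutativeRing)

IsPrimePower : ℕ → Set
IsPrimePower q = ∃[ p ] ∃[ k ] (Prime p × 1 ≤ k × q ≡ p ^ k)

record FiniteField (c ℓ : Level) (q : ℕ) : Set (lsuc (c ⊔ ℓ)) where
  field
    commutativeRing : CommutativeRing c ℓ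
  open CommutativeRing commutativeRing public
  field
    _⁻¹        : Carrier → Carrier
    ⁻¹-inverse : ∀ x → ¬ (x ≈ 0#) → (x * (x ⁻¹)) ≈ 1#
    1≉0        : ¬ (1# ≈ 0#)
    enum       : Fin q → Carrier
    enum-inj   : ∀ i j → enum i ≈ enum j → i ≡ j
    enum-surj  : ∀ x → ∃[ i ] (enum i ≈ x)

module _ {c ℓ : Level} {q : ℕ} (F : FiniteField c ℓ q) where
  open FiniteField F using (Carrier; _≈_; _+_; _*_; -_; 0#; 1#; _⁻¹)

  -- Polynomials of formal degree ≤ m are coefficient vectors
  -- Vec Carrier (suc m), index i = coefficient of x^i.

  coeff : ∀ {m} → Vec Carrier m → ℕ → Carrier
  coeff []       _       = 0#
  coeff (a ∷ as) zero    = a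
  coeff (a ∷ as) (suc k) = coeff as k

  sumTo : (ℕ → Carrier) → ℕ → Carrier
  sumTo g zero    = g zero
  sumTo g (suc k) = sumTo g k + g (suc k)

  mulCoeff : ∀ {i j} → Vec Carrier i → Vec Carrier j → ℕ → Carrier
  mulCoeff g h k = sumTo (λ a → coeff g a * coeff h (k ∸ a)) k

  HasDegree : ∀ {n} → Vec Carrier (suc n) → Set ℓ
  HasDegree f = ¬ (last f ≈ 0#)

  Irreducible : ∀ {n} → Vec Carrier (suc n) → Set (c ⊔ ℓ)
  Irreducible {n} f =
    1 ≤ n × HasDegree f ×
    (∀ i j (g : Vec Carrier (suc i)) (h : Vec Carrier (suc j)) →
       HasDegree g → HasDegree h →
       (∀ k → mulCoeff g h k ≈ coeff f k) →
       i ≡ 0 ⊎ j ≡ 0)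

  -- 𝔽_q[x]/(f), f of degree n, represented by remainders of degree < n,
  -- i.e. coefficient vectors Vec Carrier n (basis 1, x, …, x^{n-1}).
  -- η : g + (f) ↦ x g + (f), using x^n ≡ -(a_n)⁻¹ (a_0 + … + a_{n-1} x^{n-1}).
  η : ∀ {n} → Vec Carrier (suc n) → Vec Carrier n → Vec Carrier n
  η {zero}  f c = c
  η {suc m} f c =
    zipWith (λ d a → d + - (last c * ((last f ⁻¹) * a))) (0# ∷ init c) (init f)

  iter : ∀ {A : Set c} → (A → A) → ℕ → A → A
  iter g zero    x = x
  iter g (suc k) x = g (iter g k x)

  _≋_ : ∀ {n} → Vec Carrier n → Vec Carrier n → Set ℓ
  u ≋ v = ∀ i → lookup u i ≈ lookup v i

  oneV : ∀ {n} → Vec Carrier n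
  oneV {zero}  = []
  oneV {suc m} = 1# ∷ replicate m 0#

  zeroV : ∀ {n} → Vec Carrier n
  zeroV = replicate _ 0#

  _⊕_ : ∀ {n} → Vec Carrier n → Vec Carrier n → Vec Carrier n
  _⊕_ = zipWith _+_

  _·_ : ∀ {n} → Carrier → Vec Carrier n → Vec Carrier n
  a · v = map (a *_) v

  -- the multiplicative order of ω (a root of f) is T: the order of the class
  -- of x in 𝔽_q[x]/(f), i.e. least T ≥ 1 with x^T ≡ 1 (mod f); x^k mod f = η^k(1).
  HasOrder : ∀ {n} → Vec Carrier (suc n) → ℕ → Set ℓ
  HasOrder f T =
    1 ≤ T × iter (η f) T oneV ≋ oneV ×
    (∀ k → 1 ≤ k → k < T → ¬ (iter (η f) k oneV ≋ oneV))

  IsSubspace : ∀ {n} → (Vec Carrier n → Set (c ⊔ ℓ)) → Set (c ⊔ ℓ)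
  IsSubspace U =
    (∀ u v → u ≋ v → U u → U v) ×
    U zeroV ×
    (∀ u v → U u → U v → U (u ⊕ v)) ×
    (∀ a u → U u → U (a · u))

  IsProper : ∀ {n} → (Vec Carrier n → Set (c ⊔ ℓ)) → Set (c ⊔ ℓ)
  IsProper U = ∃[ v ] ¬ U v

  -- 𝔽_q[x]/(f) admits an η-covering: with T the order of η (= order of ω),
  -- some proper subspace U has ⋃_{i=0}^{T-1} η^i(U) = everything.
  AdmitsEtaCovering : ∀ {n} → Vec Carrier (suc n) → Set (lsuc (c ⊔ ℓ))
  AdmitsEtaCovering f =
    ∃[ T ] (HasOrder f T ×
      Σ (Vec Carrier _ → Set (c ⊔ ℓ)) λ U →
        IsSubspace U × IsProper U ×
        (∀ v → ∃[ i ] (i < T × ∃[ u ] (U u × iter (η f) i u ≋ v))))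

{-# OPTIONS --safe #-}

-- Let ωᵢ be the class of x in F[x]/(fᵢ), so that ηᵢ is multiplication by ωᵢ.  As ω₁ has order T,
-- f₁ divides x^T − 1, say f₁ h = x^T − 1.  Some power ω₂^j is a root of f₁: otherwise h, of degree
-- less than T, would vanish at the T distinct powers of ω₂.  Then x ↦ ω₂^j defines an F-linear map
-- φ : F[x]/(f₁) → F[x]/(f₂) with φ ∘ η₁ = η₂^j ∘ φ, injective because f₁ is irreducible.  Hence ω₂^j
-- has order T as well, j is prime to T, ω₂ is a power of ω₂^j, and φ is surjective.  So φ maps proper
-- subspaces to proper subspaces and coverings to coverings.
--
-- A polynomial p is only ever used through its action p(A) v on the vectors v of a module with an
-- endomorphism A; in particular its coefficients are p(A) v for A the shift on sequences.

module Submission where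

open import Defs
open import Level using (_⊔_)
open import Data.Nat using (ℕ; zero; suc; _∸_; _≤_; _<_; z≤n; s≤s)
import Data.Nat as ℕ
import Data.Nat.Properties as ℕₚ
open import Data.Empty using (⊥)
open import Algebra.Properties.CommutativeSemigroup ℕₚ.*-commutativeSemigroup using (x∙yz≈y∙xz)
open import Data.Nat.GCD using (GCD; gcd-GCD; gcd[m,n]∣m; gcd[m,n]∣n; module Bézout)
open import Data.Nat.Divisibility using (_∣_; divides)
open import Data.Nat.DivMod using (_/_; _%_; m≡m%n+[m/n]*n; m%n<n)
open import Data.Fin using (Fin; zero; suc; toℕ; inject₁; fromℕ)
open import Data.Vec using (Vec; []; _∷_; lookup; zipWith; map; replicate; last; init)
import Data.Vec.Properties as Vecₚ
import Data.Fin.Properties as Finₚ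
open import Data.Product using (_,_; ∃-syntax; _×_; proj₁; proj₂)
open import Data.Sum using (_⊎_; inj₁; inj₂)
open import Function.Bundles using (_⇔_; mk⇔)
open import Relation.Nullary using (¬_; Dec; yes; no; contradiction)
open import Relation.Binary.PropositionalEquality as ≡ using (_≡_)
open import Algebra.Module.Bundles using (LeftModule; RawLeftModule)
open import Algebra.Module.Morphism.Structures using (IsLeftModuleMonomorphism)
import Algebra.Module.Morphism.LeftModuleMonomorphism as LeftModuleMonomorphism
open import Algebra.Bundles using (CommutativeMonoid)
import Algebra.Construct.Pointwise as Pointwise
import Algebra.Properties.Ring
import Algebra.Properties.CommutativeSemigroup
import Relation.Binary.Reasoning.Setoid

-- No field extension and no product on F[x]/(f) is constructed: apart from the vector space
-- structure only `η` is available. A ring element is represented by multiplication by it, that is,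
-- by a linear map commuting with `η`, and its own vector is recovered by applying this map to 1.
-- The statement f₁(ω₂^j) = 0 thus reads: f₁ evaluated at the j-th iterate of `η F f₂` sends 1 to 0.
--
-- Surjectivity of φ could come from comparing dimensions, both spaces having dimension n. The
-- coprimality of j and T gives explicit preimages instead: if m inverts j modulo T, then φ sends
-- ω₁^m to (ω₂^j)^m = ω₂, and every vector is a polynomial in ω₂.

module _ {a b d} {A : Set a} {B : Set b} {D : Set d} (f : A → B → D) where

  init-zipWith : ∀ {n} (xs : Vec A (suc n)) ys → init (zipWith f xs ys) ≡ zipWith f (init xs) (init ys)
  init-zipWith (x ∷ [])      (y ∷ [])      = ≡.refl
  init-zipWith (x ∷ x′ ∷ xs) (y ∷ y′ ∷ ys) = ≡.cong (f x y ∷_) (init-zipWith (x′ ∷ xs) (y′ ∷ ys))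

  last-zipWith : ∀ {n} (xs : Vec A (suc n)) ys → last (zipWith f xs ys) ≡ f (last xs) (last ys)
  last-zipWith (x ∷ [])      (y ∷ [])      = ≡.refl
  last-zipWith (x ∷ x′ ∷ xs) (y ∷ y′ ∷ ys) = last-zipWith (x′ ∷ xs) (y′ ∷ ys)

module _ {a b} {A : Set a} {B : Set b} (f : A → B) where

  init-map : ∀ {n} (xs : Vec A (suc n)) → init (map f xs) ≡ map f (init xs)
  init-map (x ∷ [])      = ≡.refl
  init-map (x ∷ x′ ∷ xs) = ≡.cong (f x ∷_) (init-map (x′ ∷ xs))

  last-map : ∀ {n} (xs : Vec A (suc n)) → last (map f xs) ≡ f (last xs)
  last-map (x ∷ [])      = ≡.refl
  last-map (x ∷ x′ ∷ xs) = last-map (x′ ∷ xs)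

-- m is an inverse of j modulo T.
bézout : ∀ {j T} → 1 ≤ T → GCD j T 1 → ∃[ m ] ∃[ k ] ∃[ l ] m ℕ.* j ℕ.+ k ℕ.* T ≡ 1 ℕ.+ l ℕ.* T
bézout {j} {suc t} _ g with Bézout.identity g
... | Bézout.+- x y eq = x , 0 , y , ≡.trans (ℕₚ.+-identityʳ _) (≡.sym eq)
-- Here x j ≡ -1 modulo T, and t = T - 1 ≡ -1 as well, so t x inverts j. The multiple of T on the
-- left keeps the identity free of subtraction.
... | Bézout.-+ x y eq = t ℕ.* x , 1 , t ℕ.* y , (begin
  t ℕ.* x ℕ.* j ℕ.+ 1 ℕ.* suc t       ≡⟨ ≡.cong₂ ℕ._+_ (ℕₚ.*-assoc t x j) (ℕₚ.*-identityˡ (suc t)) ⟩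
  t ℕ.* (x ℕ.* j) ℕ.+ suc t           ≡⟨ ℕₚ.+-comm _ (suc t) ⟩
  suc (t ℕ.+ t ℕ.* (x ℕ.* j))         ≡⟨ ≡.cong suc (ℕₚ.*-suc t (x ℕ.* j)) ⟨
  suc (t ℕ.* suc (x ℕ.* j))           ≡⟨ ≡.cong (λ m → suc (t ℕ.* m)) eq ⟩
  suc (t ℕ.* (y ℕ.* suc t))           ≡⟨ ≡.cong suc (ℕₚ.*-assoc t y (suc t)) ⟨
  suc (t ℕ.* y ℕ.* suc t)             ∎)
  where open ≡.≡-Reasoning

module Polynomials {c ℓ q} (F : FiniteField c ℓ q) where

  open FiniteField F hiding (zero)
  open Algebra.Properties.Ring ring using (-‿distribˡ-*; -‿distribʳ-*; -0#≈0#; -‿+-comm; -‿involutive)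
  open Algebra.Properties.CommutativeSemigroup +-commutativeSemigroup using () renaming (interchange to +-interchange)

  infix 4 _≐_

  _≐_ : ∀ {n} → Vec Carrier n → Vec Carrier n → Set ℓ
  _≐_ = _≋_ F

  0ₚ : ∀ {n} → Vec Carrier n
  0ₚ = zeroV F

  -- This is where the finiteness of `F` enters: comparing indices in the enumeration decides
  -- equality. The later case distinctions on leading coefficients, zero vectors and roots rest on
  -- it.
  _≈?_ : ∀ x y → Dec (x ≈ y)
  x ≈? y with enum-surj x | enum-surj y
  ... | i , ei≈x | j , ej≈y with i Data.Fin.≟ j
  ... | yes ≡.refl = yes (trans (sym ei≈x) ej≈y)
  ... | no i≢j     = no λ x≈y → i≢j (enum-inj i j (trans ei≈x (trans x≈y (sym ej≈y))))

  -- Polynomials acting on a module with an endomorphism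

  module LinearOperators (M : LeftModule ring c ℓ) where

    open LeftModule M
    open Algebra.Properties.CommutativeSemigroup
           (CommutativeMonoid.commutativeSemigroup +ᴹ-commutativeMonoid)
           using (interchange)
    open import Algebra.Solver.CommutativeMonoid +ᴹ-commutativeMonoid using (solve; _⊜_) renaming (_⊕_ to _⊹_)
    open Relation.Binary.Reasoning.Setoid ≈ᴹ-setoid

    record IsLinear (A : Carrierᴹ → Carrierᴹ) : Set (c ⊔ ℓ) where
      field
        cong   : ∀ {x y} → x ≈ᴹ y → A x ≈ᴹ A y
        +-homo : ∀ x y → A (x +ᴹ y) ≈ᴹ A x +ᴹ A y
        *-homo : ∀ s x → A (s *ₗ x) ≈ᴹ s *ₗ A x

      0-homo : A 0ᴹ ≈ᴹ 0ᴹ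
      0-homo = begin
        A 0ᴹ           ≈⟨ cong (*ₗ-zeroˡ 0ᴹ) ⟨
        A (0# *ₗ 0ᴹ)   ≈⟨ *-homo 0# 0ᴹ ⟩
        0# *ₗ A 0ᴹ     ≈⟨ *ₗ-zeroˡ _ ⟩
        0ᴹ             ∎

    open IsLinear public

    Commute : (A B : Carrierᴹ → Carrierᴹ) → Set (c ⊔ ℓ)
    Commute A B = ∀ x → A (B x) ≈ᴹ B (A x)

    -- The coefficients lie in the module rather than in `F`, because dividing out a root that is a
    -- power of ω₂ leaves a quotient whose coefficients are no longer scalars. `eval` is the case of
    -- coefficients a v with a in `F`.
    horner : (Carrierᴹ → Carrierᴹ) → ∀ {m} → Vec Carrierᴹ m → Carrierᴹ
    horner A []       = 0ᴹ
    horner A (x ∷ xs) = x +ᴹ A (horner A xs)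

    eval : (Carrierᴹ → Carrierᴹ) → ∀ {m} → Vec Carrier m → Carrierᴹ → Carrierᴹ
    eval A p v = horner A (map (_*ₗ v) p)

    eval-cong : ∀ {A} → IsLinear A → ∀ {m} (p p′ : Vec Carrier m) {v v′} →
                p ≐ p′ → v ≈ᴹ v′ → eval A p v ≈ᴹ eval A p′ v′
    eval-cong A-lin []      []        p≐p′ v≈v′ = ≈ᴹ-refl
    eval-cong A-lin (a ∷ p) (a′ ∷ p′) p≐p′ v≈v′ =
      +ᴹ-cong (*ₗ-cong (p≐p′ zero) v≈v′) (cong A-lin (eval-cong A-lin p p′ (λ i → p≐p′ (suc i)) v≈v′))

    eval-⊕ : ∀ {A} → IsLinear A → ∀ {m} (p p′ : Vec Carrier m) v →
             eval A (_⊕_ F p p′) v ≈ᴹ eval A p v +ᴹ eval A p′ v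
    eval-⊕ A-lin []      []        v = ≈ᴹ-sym (+ᴹ-identityˡ 0ᴹ)
    eval-⊕ {A} A-lin (a ∷ p) (a′ ∷ p′) v = begin
      (a + a′) *ₗ v +ᴹ A (eval A (_⊕_ F p p′) v)
        ≈⟨ +ᴹ-cong (*ₗ-distribʳ v a a′) (≈ᴹ-trans (cong A-lin (eval-⊕ A-lin p p′ v)) (+-homo A-lin _ _)) ⟩
      (a *ₗ v +ᴹ a′ *ₗ v) +ᴹ (A (eval A p v) +ᴹ A (eval A p′ v))
        ≈⟨ interchange _ _ _ _ ⟩
      eval A (a ∷ p) v +ᴹ eval A (a′ ∷ p′) v ∎

    eval-· : ∀ {A} → IsLinear A → ∀ s {m} (p : Vec Carrier m) v →
             eval A (_·_ F s p) v ≈ᴹ s *ₗ eval A p v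
    eval-· A-lin s []      v = ≈ᴹ-sym (*ₗ-zeroʳ s)
    eval-· {A} A-lin s (a ∷ p) v = begin
      (s * a) *ₗ v +ᴹ A (eval A (_·_ F s p) v)
        ≈⟨ +ᴹ-cong (*ₗ-assoc s a v) (≈ᴹ-trans (cong A-lin (eval-· A-lin s p v)) (*-homo A-lin s _)) ⟩
      s *ₗ (a *ₗ v) +ᴹ s *ₗ A (eval A p v)
        ≈⟨ *ₗ-distribˡ s _ _ ⟨
      s *ₗ eval A (a ∷ p) v ∎

    eval-0ₚ : ∀ {A} → IsLinear A → ∀ m v → eval A (0ₚ {m}) v ≈ᴹ 0ᴹ
    eval-0ₚ A-lin zero    v = ≈ᴹ-refl
    eval-0ₚ {A} A-lin (suc m) v = begin
      0# *ₗ v +ᴹ A (eval A (0ₚ {m}) v) ≈⟨ +ᴹ-cong (*ₗ-zeroˡ v) (cong A-lin (eval-0ₚ A-lin m v)) ⟩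
      0ᴹ +ᴹ A 0ᴹ                       ≈⟨ +ᴹ-identityˡ _ ⟩
      A 0ᴹ                             ≈⟨ 0-homo A-lin ⟩
      0ᴹ                               ∎

    eval-oneV : ∀ {A} → IsLinear A → ∀ m v → eval A (oneV F {suc m}) v ≈ᴹ v
    eval-oneV {A} A-lin m v = begin
      1# *ₗ v +ᴹ A (eval A (0ₚ {m}) v)
        ≈⟨ +ᴹ-cong (*ₗ-identityˡ v) (≈ᴹ-trans (cong A-lin (eval-0ₚ A-lin m v)) (0-homo A-lin)) ⟩
      v +ᴹ 0ᴹ ≈⟨ +ᴹ-identityʳ v ⟩
      v ∎

    eval-const : ∀ {A} → IsLinear A → ∀ s m v → eval A (_·_ F s (oneV F {suc m})) v ≈ᴹ s *ₗ v
    eval-const A-lin s m v = ≈ᴹ-trans (eval-· A-lin s (oneV F {suc m}) v) (*ₗ-congˡ (eval-oneV A-lin m v))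

    commute-eval : ∀ {A B} → IsLinear A → IsLinear B → Commute B A →
                   ∀ {m} (p : Vec Carrier m) → Commute B (eval A p)
    commute-eval A-lin B-lin BA≈AB []      v = 0-homo B-lin
    commute-eval {A} {B} A-lin B-lin BA≈AB (a ∷ p) v = begin
      B (a *ₗ v +ᴹ A (eval A p v))
        ≈⟨ +-homo B-lin _ _ ⟩
      B (a *ₗ v) +ᴹ B (A (eval A p v))
        ≈⟨ +ᴹ-cong (*-homo B-lin a v) (≈ᴹ-trans (BA≈AB _) (cong A-lin (commute-eval A-lin B-lin BA≈AB p v))) ⟩
      eval A (a ∷ p) (B v) ∎

    scale-linear : ∀ s → IsLinear (s *ₗ_)
    scale-linear s = record
      { cong   = *ₗ-congˡ
      ; +-homo = *ₗ-distribˡ s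
      ; *-homo = λ t x → ≈ᴹ-trans (≈ᴹ-sym (*ₗ-assoc s t x)) (≈ᴹ-trans (*ₗ-congʳ (*-comm s t)) (*ₗ-assoc t s x))
      }

    eval-linear : ∀ {A} → IsLinear A → ∀ {m} (p : Vec Carrier m) → IsLinear (eval A p)
    eval-linear {A} A-lin p = record
      { cong   = eval-cong A-lin p p (λ _ → refl)
      ; +-homo = additive p
      ; *-homo = λ s x → ≈ᴹ-sym (commute-eval A-lin (scale-linear s) (λ x → ≈ᴹ-sym (*-homo A-lin s x)) p x)
      }
      where
      additive : ∀ {m} (p : Vec Carrier m) x y → eval A p (x +ᴹ y) ≈ᴹ eval A p x +ᴹ eval A p y
      additive []      x y = ≈ᴹ-sym (+ᴹ-identityˡ 0ᴹ)
      additive (a ∷ p) x y = begin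
        a *ₗ (x +ᴹ y) +ᴹ A (eval A p (x +ᴹ y))
          ≈⟨ +ᴹ-cong (*ₗ-distribˡ a x y) (≈ᴹ-trans (cong A-lin (additive p x y)) (+-homo A-lin _ _)) ⟩
        (a *ₗ x +ᴹ a *ₗ y) +ᴹ (A (eval A p x) +ᴹ A (eval A p y))
          ≈⟨ interchange _ _ _ _ ⟩
        eval A (a ∷ p) x +ᴹ eval A (a ∷ p) y ∎

    eval-init : ∀ {A} → IsLinear A → ∀ {m} (p : Vec Carrier (suc m)) v →
                last p ≈ 0# → eval A p v ≈ᴹ eval A (init p) v
    eval-init {A} A-lin (a ∷ []) v a≈0 = begin
      a *ₗ v +ᴹ A 0ᴹ   ≈⟨ +ᴹ-cong (*ₗ-congʳ a≈0) (0-homo A-lin) ⟩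
      0# *ₗ v +ᴹ 0ᴹ    ≈⟨ +ᴹ-identityʳ _ ⟩
      0# *ₗ v          ≈⟨ *ₗ-zeroˡ v ⟩
      0ᴹ               ∎
    eval-init A-lin (a ∷ b ∷ p) v last≈0 = +ᴹ-congˡ (cong A-lin (eval-init A-lin (b ∷ p) v last≈0))

    iter-linear : ∀ {A} → IsLinear A → ∀ k → IsLinear (iter F A k)
    iter-linear A-lin zero    = record { cong = λ e → e ; +-homo = λ _ _ → ≈ᴹ-refl ; *-homo = λ _ _ → ≈ᴹ-refl }
    iter-linear A-lin (suc k) = record
      { cong   = λ e → cong A-lin (cong ih e)
      ; +-homo = λ x y → ≈ᴹ-trans (cong A-lin (+-homo ih x y)) (+-homo A-lin _ _)
      ; *-homo = λ s x → ≈ᴹ-trans (cong A-lin (*-homo ih s x)) (*-homo A-lin s _)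
      }
      where ih = iter-linear A-lin k

    commute-iter : ∀ {A B} → IsLinear A → Commute B A → ∀ k → Commute B (iter F A k)
    commute-iter A-lin BA≈AB zero    x = ≈ᴹ-refl
    commute-iter A-lin BA≈AB (suc k) x = ≈ᴹ-trans (BA≈AB _) (cong A-lin (commute-iter A-lin BA≈AB k x))

    iter-+ : ∀ (A : Carrierᴹ → Carrierᴹ) j k x → iter F A (j ℕ.+ k) x ≡ iter F A j (iter F A k x)
    iter-+ A zero    k x = ≡.refl
    iter-+ A (suc j) k x = ≡.cong A (iter-+ A j k x)

    iter-* : ∀ (A : Carrierᴹ → Carrierᴹ) j k x → iter F A (k ℕ.* j) x ≡ iter F (iter F A j) k x
    iter-* A j zero    x = ≡.refl
    iter-* A j (suc k) x = ≡.trans (iter-+ A j (k ℕ.* j) x) (≡.cong (iter F A j) (iter-* A j k x))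

    iter-fixed : ∀ {A} → IsLinear A → ∀ {x} → A x ≈ᴹ x → ∀ k → iter F A k x ≈ᴹ x
    iter-fixed A-lin Ax≈x zero    = ≈ᴹ-refl
    iter-fixed A-lin Ax≈x (suc k) = ≈ᴹ-trans (cong A-lin (iter-fixed A-lin Ax≈x k)) Ax≈x

    *ₗ-torsion-free : ∀ {a x} → ¬ x ≈ᴹ 0ᴹ → a *ₗ x ≈ᴹ 0ᴹ → a ≈ 0#
    *ₗ-torsion-free {a} {x} x≉0 ax≈0 with a ≈? 0#
    ... | yes a≈0 = a≈0
    ... | no a≉0  = contradiction (begin
      x                    ≈⟨ *ₗ-identityˡ x ⟨
      1# *ₗ x              ≈⟨ *ₗ-congʳ (trans (sym (⁻¹-inverse a a≉0)) (*-comm _ _)) ⟩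
      (a ⁻¹ * a) *ₗ x      ≈⟨ *ₗ-assoc _ _ _ ⟩
      a ⁻¹ *ₗ (a *ₗ x)     ≈⟨ *ₗ-congˡ ax≈0 ⟩
      a ⁻¹ *ₗ 0ᴹ           ≈⟨ *ₗ-zeroʳ _ ⟩
      0ᴹ                   ∎) x≉0

    difference-zero : ∀ x y → x ≈ᴹ y → x +ᴹ (- 1#) *ₗ y ≈ᴹ 0ᴹ
    difference-zero x y x≈y = begin
      x +ᴹ (- 1#) *ₗ y         ≈⟨ +ᴹ-congʳ (≈ᴹ-trans x≈y (≈ᴹ-sym (*ₗ-identityˡ y))) ⟩
      1# *ₗ y +ᴹ (- 1#) *ₗ y   ≈⟨ *ₗ-distribʳ y 1# (- 1#) ⟨
      (1# + - 1#) *ₗ y         ≈⟨ *ₗ-congʳ (-‿inverseʳ 1#) ⟩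
      0# *ₗ y                  ≈⟨ *ₗ-zeroˡ y ⟩
      0ᴹ                       ∎

    difference-zero⁻¹ : ∀ x y → x +ᴹ (- 1#) *ₗ y ≈ᴹ 0ᴹ → x ≈ᴹ y
    difference-zero⁻¹ x y x-y≈0 = begin
      x                                   ≈⟨ +ᴹ-identityʳ x ⟨
      x +ᴹ 0ᴹ                             ≈⟨ +ᴹ-congˡ (difference-zero y y ≈ᴹ-refl) ⟨
      x +ᴹ (y +ᴹ (- 1#) *ₗ y)             ≈⟨ +ᴹ-congˡ (+ᴹ-comm _ _) ⟩
      x +ᴹ ((- 1#) *ₗ y +ᴹ y)             ≈⟨ +ᴹ-assoc _ _ _ ⟨
      (x +ᴹ (- 1#) *ₗ y) +ᴹ y             ≈⟨ +ᴹ-congʳ x-y≈0 ⟩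
      0ᴹ +ᴹ y                             ≈⟨ +ᴹ-identityˡ y ⟩
      y                                   ∎

    infixl 6 _⊖_

    _⊖_ : (A B : Carrierᴹ → Carrierᴹ) → Carrierᴹ → Carrierᴹ
    (A ⊖ B) x = A x +ᴹ (- 1#) *ₗ B x

    ⊖-linear : ∀ {A B} → IsLinear A → IsLinear B → IsLinear (A ⊖ B)
    ⊖-linear {A} {B} A-lin B-lin = record
      { cong   = λ e → +ᴹ-cong (cong A-lin e) (*ₗ-congˡ (cong B-lin e))
      ; +-homo = λ x y → begin
          A (x +ᴹ y) +ᴹ (- 1#) *ₗ B (x +ᴹ y)
            ≈⟨ +ᴹ-cong (+-homo A-lin x y) (*ₗ-congˡ (+-homo B-lin x y)) ⟩
          (A x +ᴹ A y) +ᴹ (- 1#) *ₗ (B x +ᴹ B y)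
            ≈⟨ +ᴹ-congˡ (*ₗ-distribˡ (- 1#) _ _) ⟩
          (A x +ᴹ A y) +ᴹ ((- 1#) *ₗ B x +ᴹ (- 1#) *ₗ B y)
            ≈⟨ interchange _ _ _ _ ⟩
          (A ⊖ B) x +ᴹ (A ⊖ B) y ∎
      ; *-homo = λ s x → begin
          A (s *ₗ x) +ᴹ (- 1#) *ₗ B (s *ₗ x)
            ≈⟨ +ᴹ-cong (*-homo A-lin s x) (*ₗ-congˡ (*-homo B-lin s x)) ⟩
          s *ₗ A x +ᴹ (- 1#) *ₗ (s *ₗ B x)
            ≈⟨ +ᴹ-congˡ (*-homo (scale-linear (- 1#)) s (B x)) ⟩
          s *ₗ A x +ᴹ s *ₗ ((- 1#) *ₗ B x)
            ≈⟨ *ₗ-distribˡ s _ _ ⟨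
          s *ₗ (A ⊖ B) x ∎
      }

    ⊖-commute : ∀ {A B C} → IsLinear C → Commute A C → Commute B C → Commute (A ⊖ B) C
    ⊖-commute {A} {B} {C} C-lin AC≈CA BC≈CB x = begin
      A (C x) +ᴹ (- 1#) *ₗ B (C x)      ≈⟨ +ᴹ-cong (AC≈CA x) (*ₗ-congˡ (BC≈CB x)) ⟩
      C (A x) +ᴹ (- 1#) *ₗ C (B x)      ≈⟨ +ᴹ-congˡ (*-homo C-lin (- 1#) (B x)) ⟨
      C (A x) +ᴹ C ((- 1#) *ₗ B x)      ≈⟨ +-homo C-lin _ _ ⟨
      C ((A ⊖ B) x)                     ∎

    -- The quotient of the polynomial with coefficients xs ∈ M by the linear factor X − C.
    deflate : (Carrierᴹ → Carrierᴹ) → ∀ {m} → Vec Carrierᴹ (suc m) → Vec Carrierᴹ m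
    deflate C (x ∷ [])     = []
    deflate C (x ∷ y ∷ xs) = horner C (y ∷ xs) ∷ deflate C (y ∷ xs)

    -- xs(B) − xs(C) = (B − C) (deflate C xs)(B), with both sides moved so that no subtraction occurs.
    horner-deflate : ∀ {B C} → IsLinear B → IsLinear C → Commute C B → ∀ {m} (xs : Vec Carrierᴹ (suc m)) →
                     horner B xs +ᴹ C (horner B (deflate C xs)) ≈ᴹ horner C xs +ᴹ B (horner B (deflate C xs))
    horner-deflate {B} {C} B-lin C-lin CB≈BC (x ∷ []) = begin
      (x +ᴹ B 0ᴹ) +ᴹ C 0ᴹ    ≈⟨ +ᴹ-cong (+ᴹ-congˡ (0-homo B-lin)) (0-homo C-lin) ⟩
      (x +ᴹ 0ᴹ) +ᴹ 0ᴹ        ≈⟨ +ᴹ-cong (+ᴹ-congˡ (0-homo C-lin)) (0-homo B-lin) ⟨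
      (x +ᴹ C 0ᴹ) +ᴹ B 0ᴹ    ∎
    horner-deflate {B} {C} B-lin C-lin CB≈BC (x ∷ xs@(_ ∷ _)) = begin
      (x +ᴹ B (horner B xs)) +ᴹ C (horner C xs +ᴹ B h)
        ≈⟨ +ᴹ-congˡ (≈ᴹ-trans (+-homo C-lin _ _) (+ᴹ-congˡ (CB≈BC h))) ⟩
      (x +ᴹ B (horner B xs)) +ᴹ (C (horner C xs) +ᴹ B (C h))
        ≈⟨ solve 4 (λ x y z w → (x ⊹ y) ⊹ (z ⊹ w) ⊜ (x ⊹ z) ⊹ (y ⊹ w)) ≈ᴹ-refl _ _ _ _ ⟩
      (x +ᴹ C (horner C xs)) +ᴹ (B (horner B xs) +ᴹ B (C h))
        ≈⟨ +ᴹ-congˡ (≈ᴹ-trans (≈ᴹ-sym (+-homo B-lin _ _)) (cong B-lin (horner-deflate B-lin C-lin CB≈BC xs))) ⟩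
      (x +ᴹ C (horner C xs)) +ᴹ B (horner C xs +ᴹ B h) ∎
      where h = horner B (deflate C xs)

    -- The entries of `deflate C xs` are the values at `C` of the proper nonempty tails of `xs`.
    -- Each coefficient is the value of the tail starting at it minus `C` applied to the value of
    -- the next tail, so it vanishes once these values do.
    deflate-zero : ∀ {C} → IsLinear C → ∀ {m} (xs : Vec Carrierᴹ (suc m)) → horner C xs ≈ᴹ 0ᴹ →
                   (∀ i → lookup (deflate C xs) i ≈ᴹ 0ᴹ) → ∀ i → lookup xs i ≈ᴹ 0ᴹ
    deflate-zero {C} C-lin (x ∷ []) root d≈0 zero = begin
      x            ≈⟨ +ᴹ-identityʳ x ⟨
      x +ᴹ 0ᴹ      ≈⟨ +ᴹ-congˡ (0-homo C-lin) ⟨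
      x +ᴹ C 0ᴹ    ≈⟨ root ⟩
      0ᴹ           ∎
    deflate-zero {C} C-lin (x ∷ xs@(_ ∷ _)) root d≈0 zero = begin
      x                       ≈⟨ +ᴹ-identityʳ x ⟨
      x +ᴹ 0ᴹ                 ≈⟨ +ᴹ-congˡ (≈ᴹ-trans (cong C-lin (d≈0 zero)) (0-homo C-lin)) ⟨
      x +ᴹ C (horner C xs)    ≈⟨ root ⟩
      0ᴹ                      ∎
    deflate-zero C-lin (x ∷ xs@(_ ∷ _)) root d≈0 (suc i) =
      deflate-zero C-lin xs (d≈0 zero) (λ j → d≈0 (suc j)) i

    -- Induction on the number of coefficients, splitting off the root `B m`. At another root `B i`,
    -- `horner-deflate` leaves `B i` and `B m` agreeing on the value there of the quotient. The
    -- separation hypothesis, which does the work of cancelling a nonzero difference of roots in a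
    -- field, makes that value zero, so the quotient again has as many roots as coefficients.
    too-many-roots :
      ∀ T (B : ℕ → Carrierᴹ → Carrierᴹ) → (∀ i → IsLinear (B i)) → (∀ i j → Commute (B i) (B j)) →
      (∀ {i j x} → i < j → j < T → B i x ≈ᴹ B j x → x ≈ᴹ 0ᴹ) →
      ∀ {m} (xs : Vec Carrierᴹ m) → m ≤ T → (∀ {i} → i < m → horner (B i) xs ≈ᴹ 0ᴹ) →
      ∀ i → lookup xs i ≈ᴹ 0ᴹ
    too-many-roots T B B-lin B-comm separated {suc m} xs m<T roots =
      deflate-zero (B-lin m) xs (roots ℕₚ.≤-refl)
        (too-many-roots T B B-lin B-comm separated (deflate (B m) xs) (ℕₚ.<⇒≤ m<T) λ {i} i<m →
          separated i<m m<T (roots-coincide i<m))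
      where
      roots-coincide : ∀ {i} → i < m →
        B i (horner (B i) (deflate (B m) xs)) ≈ᴹ B m (horner (B i) (deflate (B m) xs))
      roots-coincide {i} i<m = begin
        B i h                        ≈⟨ +ᴹ-identityˡ _ ⟨
        0ᴹ +ᴹ B i h                  ≈⟨ +ᴹ-congʳ (roots ℕₚ.≤-refl) ⟨
        horner (B m) xs +ᴹ B i h     ≈⟨ horner-deflate (B-lin i) (B-lin m) (B-comm m i) xs ⟨
        horner (B i) xs +ᴹ B m h     ≈⟨ +ᴹ-congʳ (roots (ℕₚ.m<n⇒m<1+n i<m)) ⟩
        0ᴹ +ᴹ B m h                  ≈⟨ +ᴹ-identityˡ _ ⟩
        B m h                        ∎
        where h = horner (B i) (deflate (B m) xs)

    -- η g reduces x·u modulo g, so it replaces multiplication by A up to a multiple of g.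
    eval-η : ∀ {A} → IsLinear A → ∀ {d} (g : Vec Carrier (suc (suc d))) → HasDegree F g →
             ∀ (u : Vec Carrier (suc d)) v →
             A (eval A u v) ≈ᴹ eval A (η F g u) v +ᴹ (last u * last g ⁻¹) *ₗ eval A g v
    eval-η {A} A-lin {d} g g≉0 u v = ≈ᴹ-sym (begin
      eval A (η F g u) v +ᴹ s *ₗ eval A g v
        ≈⟨ +ᴹ-congʳ (≈ᴹ-trans (≈ᴹ-sym (eval-cong A-lin (init w) (η F g u) init-w ≈ᴹ-refl))
                              (≈ᴹ-sym (eval-init A-lin w v last-w))) ⟩
      eval A w v +ᴹ s *ₗ eval A g v
        ≈⟨ +ᴹ-congʳ (≈ᴹ-trans (eval-⊕ A-lin (0# ∷ u) (_·_ F (- s) g) v)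
                              (+ᴹ-cong shifted (eval-· A-lin (- s) g v))) ⟩
      (A (eval A u v) +ᴹ (- s) *ₗ eval A g v) +ᴹ s *ₗ eval A g v
        ≈⟨ +ᴹ-assoc _ _ _ ⟩
      A (eval A u v) +ᴹ ((- s) *ₗ eval A g v +ᴹ s *ₗ eval A g v)
        ≈⟨ +ᴹ-congˡ (≈ᴹ-sym (*ₗ-distribʳ _ (- s) s)) ⟩
      A (eval A u v) +ᴹ (- s + s) *ₗ eval A g v
        ≈⟨ +ᴹ-congˡ (≈ᴹ-trans (*ₗ-congʳ (-‿inverseˡ s)) (*ₗ-zeroˡ _)) ⟩
      A (eval A u v) +ᴹ 0ᴹ
        ≈⟨ +ᴹ-identityʳ _ ⟩
      A (eval A u v) ∎)
      where
      s = last u * last g ⁻¹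
      -- This is x u - s g with one coefficient more than `u`: `s` is chosen to cancel the top one,
      -- and the others are those of `η F g u`.
      w = _⊕_ F (0# ∷ u) (_·_ F (- s) g)

      shifted : eval A (0# ∷ u) v ≈ᴹ A (eval A u v)
      shifted = ≈ᴹ-trans (+ᴹ-congʳ (*ₗ-zeroˡ v)) (+ᴹ-identityˡ _)

      module R = Relation.Binary.Reasoning.Setoid setoid

      last-w : last w ≈ 0#
      last-w = R.begin
        last w                                 R.≡⟨ last-zipWith _+_ (0# ∷ u) (_·_ F (- s) g) ⟩
        last u + last (_·_ F (- s) g)          R.≡⟨ ≡.cong (last u +_) (last-map (- s *_) g) ⟩
        last u + - s * last g                  R.≈⟨ +-congˡ (sym (-‿distribˡ-* s (last g))) ⟩
        last u + - (s * last g)                R.≈⟨ +-congˡ (-‿cong (*-assoc _ _ _)) ⟩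
        last u + - (last u * (last g ⁻¹ * last g))
          R.≈⟨ +-congˡ (-‿cong (*-congˡ (trans (*-comm _ _) (⁻¹-inverse _ g≉0)))) ⟩
        last u + - (last u * 1#)               R.≈⟨ +-congˡ (-‿cong (*-identityʳ _)) ⟩
        last u + - last u                      R.≈⟨ -‿inverseʳ _ ⟩
        0#                                     R.∎

      entry : ∀ t a → t + - s * a ≈ t + - (last u * (last g ⁻¹ * a))
      entry t a = +-congˡ (trans (sym (-‿distribˡ-* s a)) (-‿cong (*-assoc _ _ _)))

      init-w : init w ≐ η F g u
      init-w i
        rewrite init-zipWith _+_ (0# ∷ u) (_·_ F (- s) g)
              | init-map (- s *_) g
              | Vecₚ.lookup-zipWith _+_ i (0# ∷ init u) (map (- s *_) (init g))
              | Vecₚ.lookup-map i (- s *_) (init g)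
              | Vecₚ.lookup-zipWith (λ t a → t + - (last u * (last g ⁻¹ * a))) i (0# ∷ init u) (init g)
        = entry (lookup (0# ∷ init u) i) (lookup (init g) i)

  -- Coefficient sequences and products of polynomials

  -- Two index sets matter: over `ℕ` these are coefficient sequences, on which polynomials act by
  -- multiplication; over `Fin n` they supply the module laws that `Vectors` pulls back along
  -- `lookup`.
  Functions : Set → LeftModule ring c ℓ
  Functions I = record
    { Carrierᴹ = I → Carrier
    ; _≈ᴹ_     = λ s t → ∀ i → s i ≈ t i
    ; _+ᴹ_     = λ s t i → s i + t i
    ; _*ₗ_     = λ a s i → a * s i
    ; 0ᴹ       = λ i → 0#
    ; -ᴹ_      = λ s i → - s i
    ; isLeftModule = record
      { isLeftSemimodule = record
        { +ᴹ-isCommutativeMonoid = Pointwise.isCommutativeMonoid I +-isCommutativeMonoid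
        ; isPreleftSemimodule = record
          { *ₗ-cong      = λ a≈b s≈t i → *-cong a≈b (s≈t i)
          ; *ₗ-zeroˡ     = λ s i → zeroˡ (s i)
          ; *ₗ-distribʳ  = λ s a b i → distribʳ (s i) a b
          ; *ₗ-identityˡ = λ s i → *-identityˡ (s i)
          ; *ₗ-assoc     = λ a b s i → *-assoc a b (s i)
          ; *ₗ-zeroʳ     = λ a i → zeroʳ a
          ; *ₗ-distribˡ  = λ a s t i → distribˡ a (s i) (t i)
          }
        }
      ; -ᴹ‿cong    = λ s≈t i → -‿cong (s≈t i)
      ; -ᴹ‿inverse = (λ s i → -‿inverseˡ (s i)) , (λ s i → -‿inverseʳ (s i))
      }
    }

  coeff-beyond : ∀ {m} (p : Vec Carrier m) {k} → m ≤ k → coeff F p k ≈ 0#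
  coeff-beyond []      _         = refl
  coeff-beyond (a ∷ p) (s≤s m≤k) = coeff-beyond p m≤k

  coeff-last : ∀ {m} (p : Vec Carrier (suc m)) → coeff F p m ≡ last p
  coeff-last (a ∷ [])    = ≡.refl
  coeff-last (a ∷ b ∷ p) = coeff-last (b ∷ p)

  coeff-toℕ : ∀ {m} (p : Vec Carrier m) i → coeff F p (toℕ i) ≡ lookup p i
  coeff-toℕ (a ∷ p) zero    = ≡.refl
  coeff-toℕ (a ∷ p) (suc i) = coeff-toℕ p i

  lookup-init : ∀ {m} (p : Vec Carrier (suc m)) i → lookup (init p) i ≡ lookup p (inject₁ i)
  lookup-init (a ∷ b ∷ p) zero    = ≡.refl
  lookup-init (a ∷ b ∷ p) (suc i) = lookup-init (b ∷ p) i

  0ₚ-intro : ∀ {m} (p : Vec Carrier (suc m)) → init p ≐ 0ₚ → last p ≈ 0# → p ≐ 0ₚ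
  0ₚ-intro (a ∷ [])    init≐0 a≈0    zero    = a≈0
  0ₚ-intro (a ∷ b ∷ p) init≐0 last≈0 zero    = init≐0 zero
  0ₚ-intro (a ∷ b ∷ p) init≐0 last≈0 (suc i) = 0ₚ-intro (b ∷ p) (λ j → init≐0 (suc j)) last≈0 i

  -- `Irreducible` speaks only of factors with nonzero leading coefficient, whereas the quotients
  -- produced by division may carry leading zeros. Agreement of all coefficients is what lets a
  -- factorisation survive the trimming.
  trim : ∀ {m} (p : Vec Carrier m) → p ≐ 0ₚ ⊎
         ∃[ j ] ∃[ p′ ] (HasDegree F {j} p′ × ∀ k → coeff F p k ≈ coeff F p′ k)
  trim [] = inj₁ λ ()
  trim (a ∷ p) with trim p
  ... | inj₂ (j , p′ , deg , eq) = inj₂ (suc j , a ∷ p′ , last≉0 p′ deg , λ { zero → refl ; (suc k) → eq k })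
    where
    last≉0 : ∀ {j} (p′ : Vec Carrier (suc j)) → HasDegree F p′ → HasDegree F (a ∷ p′)
    last≉0 (b ∷ p′) deg = deg
  ... | inj₁ p≐0 with a ≈? 0#
  ...   | yes a≈0 = inj₁ λ { zero → a≈0 ; (suc i) → p≐0 i }
  ...   | no a≉0  = inj₂ (0 , a ∷ [] , a≉0 , λ { zero → refl ; (suc k) → 0ₚ-coeff p p≐0 k })
    where
    0ₚ-coeff : ∀ {m} (p : Vec Carrier m) → p ≐ 0ₚ → ∀ k → coeff F p k ≈ 0#
    0ₚ-coeff []      p≐0 k       = refl
    0ₚ-coeff (b ∷ p) p≐0 zero    = p≐0 zero
    0ₚ-coeff (b ∷ p) p≐0 (suc k) = 0ₚ-coeff p (λ i → p≐0 (suc i)) k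

  module Sequences where

    open LeftModule (Functions ℕ)
    open LinearOperators (Functions ℕ)

    shift : (ℕ → Carrier) → (ℕ → Carrier)
    shift s zero    = 0#
    shift s (suc k) = s k

    shift-linear : IsLinear shift
    shift-linear = record
      { cong   = λ { s≈t zero → refl ; s≈t (suc k) → s≈t k }
      ; +-homo = λ { s t zero → sym (+-identityˡ 0#) ; s t (suc k) → refl }
      ; *-homo = λ { a s zero → sym (zeroʳ a) ; a s (suc k) → refl }
      }

    sumTo-cong : ∀ {g h} → (∀ k → g k ≈ h k) → ∀ k → sumTo F g k ≈ sumTo F h k
    sumTo-cong g≈h zero    = g≈h zero
    sumTo-cong g≈h (suc k) = +-cong (sumTo-cong g≈h k) (g≈h (suc k))

    sumTo-suc : ∀ g k → sumTo F g (suc k) ≈ g 0 + sumTo F (λ i → g (suc i)) k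
    sumTo-suc g zero    = refl
    sumTo-suc g (suc k) = trans (+-congʳ (sumTo-suc g k)) (+-assoc _ _ _)

    sumTo-0 : ∀ k → sumTo F (λ _ → 0#) k ≈ 0#
    sumTo-0 zero    = refl
    sumTo-0 (suc k) = trans (+-identityʳ _) (sumTo-0 k)

    -- With `shift` as multiplication by x, the convolution unfolds like Horner's scheme: its first
    -- term comes from the head of `g`, the rest is the convolution with the tail at the preceding
    -- index. This links the products in `Irreducible` to identities proved for arbitrary modules.
    mulCoeff-eval : ∀ {i j} (g : Vec Carrier i) (h : Vec Carrier j) k →
                    mulCoeff F g h k ≈ eval shift g (coeff F h) k
    mulCoeff-eval []      h k       = trans (sumTo-cong (λ _ → zeroˡ _) k) (sumTo-0 k)
    mulCoeff-eval (a ∷ g) h zero    = sym (+-identityʳ _)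
    mulCoeff-eval (a ∷ g) h (suc k) = trans (sumTo-suc (λ i → coeff F (a ∷ g) i * coeff F h (suc k ∸ i)) k)
                                            (+-congˡ (mulCoeff-eval g h k))

    δ : ℕ → Carrier
    δ = coeff F (1# ∷ [])

    -- `δ` is the constant polynomial 1, so acting on it returns the polynomial itself. Identities
    -- between actions become identities between coefficients.
    eval-δ : ∀ {m} (p : Vec Carrier m) → eval shift p δ ≈ᴹ coeff F p
    eval-δ []      k       = refl
    eval-δ (a ∷ p) zero    = trans (+-identityʳ _) (*-identityʳ a)
    eval-δ (a ∷ p) (suc k) = trans (+-cong (zeroʳ a) (eval-δ p k)) (+-identityˡ _)

  -- Euclidean division and irreducible polynomials

  module Division {d} (g : Vec Carrier (suc (suc d))) (g-deg : HasDegree F g) where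

    -- Horner's scheme in F[x]/(g): `η F g` multiplies the remainder by x, and the multiple of `g`
    -- that it subtracts has as factor the next quotient coefficient. The quotient is one entry
    -- shorter than the dividend whatever the degree of `g`, so its leading entries may be zero.
    quotient : ∀ {m} → Vec Carrier (suc m) → Vec Carrier m
    remainder : ∀ {m} → Vec Carrier (suc m) → Vec Carrier (suc d)

    quotient (a ∷ [])    = []
    quotient (a ∷ b ∷ p) = last (remainder (b ∷ p)) * last g ⁻¹ ∷ quotient (b ∷ p)

    remainder (a ∷ [])    = _·_ F a (oneV F)
    remainder (a ∷ b ∷ p) = _⊕_ F (_·_ F a (oneV F)) (η F g (remainder (b ∷ p)))

    module _ (M : LeftModule ring c ℓ) where

      open LeftModule M
      open LinearOperators M
      open Relation.Binary.Reasoning.Setoid ≈ᴹ-setoid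
      open import Algebra.Solver.CommutativeMonoid +ᴹ-commutativeMonoid using (solve; _⊜_) renaming (_⊕_ to _⊹_)

      division : ∀ {A} → IsLinear A → ∀ {m} (p : Vec Carrier (suc m)) v →
                 eval A p v ≈ᴹ eval A (quotient p) (eval A g v) +ᴹ eval A (remainder p) v
      division {A} A-lin (a ∷ []) v = begin
        a *ₗ v +ᴹ A 0ᴹ                            ≈⟨ +ᴹ-congˡ (0-homo A-lin) ⟩
        a *ₗ v +ᴹ 0ᴹ                              ≈⟨ +ᴹ-comm _ _ ⟩
        0ᴹ +ᴹ a *ₗ v                              ≈⟨ +ᴹ-congˡ (eval-const A-lin a d v) ⟨
        0ᴹ +ᴹ eval A (_·_ F a (oneV F {suc d})) v    ∎
      division {A} A-lin (a ∷ b ∷ p) v = begin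
        a *ₗ v +ᴹ A (eval A (b ∷ p) v)
          ≈⟨ +ᴹ-congˡ (cong A-lin (division A-lin (b ∷ p) v)) ⟩
        a *ₗ v +ᴹ A (eval A q′ gv +ᴹ eval A r′ v)
          ≈⟨ +ᴹ-congˡ (≈ᴹ-trans (+-homo A-lin _ _) (+ᴹ-congˡ (eval-η A-lin g g-deg r′ v))) ⟩
        a *ₗ v +ᴹ (A (eval A q′ gv) +ᴹ (eval A (η F g r′) v +ᴹ s *ₗ gv))
          ≈⟨ solve 4 (λ w x y z → w ⊹ (x ⊹ (y ⊹ z)) ⊜ (z ⊹ x) ⊹ (w ⊹ y)) ≈ᴹ-refl _ _ _ _ ⟩
        (s *ₗ gv +ᴹ A (eval A q′ gv)) +ᴹ (a *ₗ v +ᴹ eval A (η F g r′) v)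
          ≈⟨ +ᴹ-congˡ (≈ᴹ-trans (eval-⊕ A-lin (_·_ F a (oneV F {suc d})) (η F g r′) v)
                                (+ᴹ-congʳ (eval-const A-lin a d v))) ⟨
        eval A (quotient (a ∷ b ∷ p)) gv +ᴹ eval A (remainder (a ∷ b ∷ p)) v ∎
        where
        r′ = remainder (b ∷ p)
        q′ = quotient (b ∷ p)
        gv = eval A g v
        s  = last r′ * last g ⁻¹

      remainder-annihilates : ∀ {A} → IsLinear A → ∀ {m} (p : Vec Carrier (suc m)) {v} →
                              eval A g v ≈ᴹ 0ᴹ → eval A p v ≈ᴹ 0ᴹ → eval A (remainder p) v ≈ᴹ 0ᴹ
      remainder-annihilates {A} A-lin p {v} gv≈0 pv≈0 = begin
        eval A (remainder p) v                                         ≈⟨ +ᴹ-identityˡ _ ⟨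
        0ᴹ +ᴹ eval A (remainder p) v                                   ≈⟨ +ᴹ-congʳ (0-homo h-lin) ⟨
        eval A (quotient p) 0ᴹ +ᴹ eval A (remainder p) v               ≈⟨ +ᴹ-congʳ (cong h-lin gv≈0) ⟨
        eval A (quotient p) (eval A g v) +ᴹ eval A (remainder p) v     ≈⟨ division A-lin p v ⟨
        eval A p v                                                     ≈⟨ pv≈0 ⟩
        0ᴹ                                                             ∎
        where h-lin = eval-linear A-lin (quotient p)

  open Division using (quotient; remainder; division; remainder-annihilates)

  module _ {n} {f : Vec Carrier (suc n)} (f-irr : Irreducible F f) where

    private
      f-deg : HasDegree F f
      f-deg = proj₁ (proj₂ f-irr)

    -- A zero remainder gives f = h g. If h is zero, so is the top coefficient of `f`. Otherwise
    -- irreducibility forces the trimmed h to be constant, `g` having positive degree, and then the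
    -- product has degree below `n`.
    irreducible⇒no-proper-divisor :
      ∀ {d} (g : Vec Carrier (suc (suc d))) (g-deg : HasDegree F g) → suc d < n →
      ¬ remainder g g-deg f ≐ 0ₚ
    irreducible⇒no-proper-divisor {d} g g-deg d<n r≐0 = go (trim h)
      where
      open LinearOperators (Functions ℕ)
      open Sequences
      open Relation.Binary.Reasoning.Setoid setoid

      h = quotient g g-deg f
      r = remainder g g-deg f

      factorisation : ∀ k → mulCoeff F h g k ≈ coeff F f k
      factorisation k = begin
        mulCoeff F h g k
          ≈⟨ mulCoeff-eval h g k ⟩
        eval shift h (coeff F g) k
          ≈⟨ cong (eval-linear shift-linear h) (eval-δ g) k ⟨
        eval shift h (eval shift g δ) k
          ≈⟨ +-identityʳ _ ⟨
        eval shift h (eval shift g δ) k + 0#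
          ≈⟨ +-congˡ (eval-0ₚ shift-linear (suc d) δ k) ⟨
        eval shift h (eval shift g δ) k + eval shift (0ₚ {suc d}) δ k
          ≈⟨ +-congˡ (eval-cong shift-linear r 0ₚ r≐0 (λ _ → refl) k) ⟨
        eval shift h (eval shift g δ) k + eval shift r δ k
          ≈⟨ division g g-deg (Functions ℕ) shift-linear f δ k ⟨
        eval shift f δ k
          ≈⟨ eval-δ f k ⟩
        coeff F f k ∎

      top-coeff-nonzero : ¬ coeff F f n ≈ 0#
      top-coeff-nonzero fn≈0 = f-deg (trans (reflexive (≡.sym (coeff-last f))) fn≈0)

      mulCoeff-congˡ : ∀ {i j} (p : Vec Carrier i) (p′ : Vec Carrier j) →
                       (∀ k → coeff F p k ≈ coeff F p′ k) → ∀ k → mulCoeff F p′ g k ≈ mulCoeff F p g k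
      mulCoeff-congˡ p p′ p≈p′ k = sumTo-cong (λ i → *-congʳ (sym (p≈p′ i))) k

      mulCoeff-const : ∀ a {k} → suc (suc d) ≤ k → mulCoeff F (a ∷ []) g k ≈ 0#
      mulCoeff-const a {suc k} d≤k = begin
        mulCoeff F (a ∷ []) g (suc k)          ≈⟨ mulCoeff-eval (a ∷ []) g (suc k) ⟩
        a * coeff F g (suc k) + 0#             ≈⟨ +-identityʳ _ ⟩
        a * coeff F g (suc k)                  ≈⟨ *-congˡ (coeff-beyond g d≤k) ⟩
        a * 0#                                 ≈⟨ zeroʳ a ⟩
        0#                                     ∎

      go : h ≐ 0ₚ ⊎ (∃[ j ] ∃[ h′ ] (HasDegree F {j} h′ × ∀ k → coeff F h k ≈ coeff F h′ k)) → ⊥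
      go (inj₁ h≐0) = top-coeff-nonzero (begin
        coeff F f n                      ≈⟨ factorisation n ⟨
        mulCoeff F h g n                 ≈⟨ mulCoeff-eval h g n ⟩
        eval shift h (coeff F g) n       ≈⟨ eval-cong shift-linear h 0ₚ h≐0 (λ _ → refl) n ⟩
        eval shift (0ₚ {n}) (coeff F g) n  ≈⟨ eval-0ₚ shift-linear n (coeff F g) n ⟩
        0#                               ∎)
      go (inj₂ (j , h′ , h′-deg , h≈h′))
        with proj₂ (proj₂ f-irr) j (suc d) h′ g h′-deg g-deg
               (λ k → trans (mulCoeff-congˡ h h′ h≈h′ k) (factorisation k))
      go (inj₂ (0 , a ∷ [] , h′-deg , h≈h′)) | inj₁ ≡.refl = top-coeff-nonzero (begin
        coeff F f n                      ≈⟨ factorisation n ⟨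
        mulCoeff F h g n                 ≈⟨ mulCoeff-congˡ h (a ∷ []) h≈h′ n ⟨
        mulCoeff F (a ∷ []) g n          ≈⟨ mulCoeff-const a d<n ⟩
        0#                               ∎)

    module _ (M : LeftModule ring c ℓ) where

      open LeftModule M
      open LinearOperators M
      open Relation.Binary.Reasoning.Setoid ≈ᴹ-setoid

      -- A nonzero polynomial of least degree annihilating v divides f, hence has degree n.
      annihilator-trivial :
        ∀ {A} → IsLinear A → ∀ {v} → ¬ v ≈ᴹ 0ᴹ → eval A f v ≈ᴹ 0ᴹ →
        ∀ {m} (p : Vec Carrier m) → m ≤ n → eval A p v ≈ᴹ 0ᴹ → p ≐ 0ₚ
      annihilator-trivial {A} A-lin {v} v≉0 fv≈0 = go
        where
        go : ∀ {m} (p : Vec Carrier m) → m ≤ n → eval A p v ≈ᴹ 0ᴹ → p ≐ 0ₚ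
        go [] _ _ ()
        go (a ∷ p) m≤n pv≈0 with last (a ∷ p) ≈? 0#
        ... | yes last≈0 = 0ₚ-intro (a ∷ p) (go (init (a ∷ p)) (ℕₚ.<⇒≤ m≤n) init-pv≈0) last≈0
          where init-pv≈0 = ≈ᴹ-trans (≈ᴹ-sym (eval-init A-lin (a ∷ p) v last≈0)) pv≈0
        go (a ∷ []) m≤n av≈0 | no a≉0 = contradiction (*ₗ-torsion-free v≉0 (begin
          a *ₗ v            ≈⟨ +ᴹ-identityʳ _ ⟨
          a *ₗ v +ᴹ 0ᴹ      ≈⟨ +ᴹ-congˡ (0-homo A-lin) ⟨
          a *ₗ v +ᴹ A 0ᴹ    ≈⟨ av≈0 ⟩
          0ᴹ                ∎)) a≉0
        -- Descent on the length: the remainder of `f` by `p` annihilates `v` too and is one entry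
        -- shorter than `p`, so it vanishes by recursion. Since `m≤n` counts coefficients, `p` has
        -- degree below `n` and would be a proper divisor of `f`.
        go p@(_ ∷ _ ∷ _) m≤n pv≈0 | no p-deg =
          contradiction (go (remainder p p-deg f) (ℕₚ.<⇒≤ m≤n) (remainder-annihilates p p-deg M A-lin f pv≈0 fv≈0))
                        (irreducible⇒no-proper-divisor p p-deg m≤n)

  -- Multiplication maps on a cyclic module

  module _ (M : LeftModule ring c ℓ) where

    open LeftModule M
    open LinearOperators M

    module CyclicModule
      {A : Carrierᴹ → Carrierᴹ} (A-lin : IsLinear A) (1ᴹ : Carrierᴹ) (≈0? : ∀ x → Dec (x ≈ᴹ 0ᴹ))
      {n} (coords : Carrierᴹ → Vec Carrier n) (eval-coords : ∀ x → eval A (coords x) 1ᴹ ≈ᴹ x)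
      {f : Vec Carrier (suc n)} (f-irr : Irreducible F f) (eval-f : eval A f 1ᴹ ≈ᴹ 0ᴹ)
      where

      open Relation.Binary.Reasoning.Setoid ≈ᴹ-setoid

      record IsEquivariant (B : Carrierᴹ → Carrierᴹ) : Set (c ⊔ ℓ) where
        field
          linear   : IsLinear B
          commutes : Commute B A

        determined-by-1ᴹ : ∀ x → B x ≈ᴹ eval A (coords x) (B 1ᴹ)
        determined-by-1ᴹ x = begin
          B x                             ≈⟨ cong linear (eval-coords x) ⟨
          B (eval A (coords x) 1ᴹ)        ≈⟨ commute-eval A-lin linear commutes (coords x) 1ᴹ ⟩
          eval A (coords x) (B 1ᴹ)        ∎

      open IsEquivariant

      -- Every vector is a polynomial in `A` applied to `1ᴹ`, and both maps commute with such
      -- polynomials. This extends facts known at `1ᴹ` alone, such as the equation in `HasOrder`, to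
      -- the whole module.
      equivariant-unique : ∀ {B C} → IsEquivariant B → IsEquivariant C → B 1ᴹ ≈ᴹ C 1ᴹ → ∀ x → B x ≈ᴹ C x
      equivariant-unique {B} {C} B-eq C-eq B1≈C1 x = begin
        B x                         ≈⟨ determined-by-1ᴹ B-eq x ⟩
        eval A (coords x) (B 1ᴹ)    ≈⟨ cong (eval-linear A-lin (coords x)) B1≈C1 ⟩
        eval A (coords x) (C 1ᴹ)    ≈⟨ determined-by-1ᴹ C-eq x ⟨
        C x                         ∎

      eval-equivariant : ∀ {B} → IsEquivariant B → ∀ {m} (p : Vec Carrier m) → IsEquivariant (eval B p)
      eval-equivariant B-eq p = record
        { linear   = eval-linear (linear B-eq) p
        ; commutes = λ x → ≈ᴹ-sym (commute-eval (linear B-eq) A-lin (λ y → ≈ᴹ-sym (commutes B-eq y)) p x)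
        }

      ⊖-equivariant : ∀ {B C} → IsEquivariant B → IsEquivariant C → IsEquivariant (B ⊖ C)
      ⊖-equivariant B-eq C-eq = record
        { linear   = ⊖-linear (linear B-eq) (linear C-eq)
        ; commutes = ⊖-commute A-lin (commutes B-eq) (commutes C-eq)
        }

      iter-equivariant : ∀ k → IsEquivariant (iter F A k)
      iter-equivariant k = record
        { linear   = iter-linear A-lin k
        ; commutes = λ x → ≈ᴹ-sym (commute-iter {B = A} A-lin (λ _ → ≈ᴹ-refl) k x)
        }

      iter-commute : ∀ j k → Commute (iter F A j) (iter F A k)
      iter-commute j = commute-iter A-lin (commutes (iter-equivariant j))

      0-equivariant : IsEquivariant (λ _ → 0ᴹ)
      0-equivariant = record
        { linear   = record { cong   = λ _ → ≈ᴹ-refl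
                            ; +-homo = λ _ _ → ≈ᴹ-sym (+ᴹ-identityˡ 0ᴹ)
                            ; *-homo = λ s _ → ≈ᴹ-sym (*ₗ-zeroʳ s) }
        ; commutes = λ _ → ≈ᴹ-sym (0-homo A-lin)
        }

      -- B is multiplication by B 1ᴹ, so this says that M = F[x]/(f) has no zero divisors.
      no-zero-divisors : ∀ {B} → IsEquivariant B → ∀ {x} → ¬ x ≈ᴹ 0ᴹ → B x ≈ᴹ 0ᴹ → B 1ᴹ ≈ᴹ 0ᴹ
      no-zero-divisors {B} B-eq {x} x≉0 Bx≈0 = begin
        B 1ᴹ                            ≈⟨ eval-coords _ ⟨
        eval A b 1ᴹ                     ≈⟨ eval-cong A-lin b 0ₚ b≐0 ≈ᴹ-refl ⟩
        eval A (0ₚ {n}) 1ᴹ              ≈⟨ eval-0ₚ A-lin n 1ᴹ ⟩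
        0ᴹ                              ∎
        where
        b = coords (B 1ᴹ)

        multiplication-by-b : ∀ y → eval A b y ≈ᴹ B y
        multiplication-by-b = equivariant-unique (eval-equivariant A-eq b) B-eq (eval-coords (B 1ᴹ))
          where A-eq = record { linear = A-lin ; commutes = λ _ → ≈ᴹ-refl }

        eval-f-x : eval A f x ≈ᴹ 0ᴹ
        eval-f-x = equivariant-unique (eval-equivariant (iter-equivariant 1) f) 0-equivariant eval-f x

        b≐0 : b ≐ 0ₚ
        b≐0 = annihilator-trivial f-irr M A-lin x≉0 eval-f-x b ℕₚ.≤-refl
                (≈ᴹ-trans (multiplication-by-b x) Bx≈0)

      module _ {T} (1≤T : 1 ≤ T) (A^T : iter F A T 1ᴹ ≈ᴹ 1ᴹ)
               (minimal : ∀ k → 1 ≤ k → k < T → ¬ iter F A k 1ᴹ ≈ᴹ 1ᴹ) where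

        iter-T : ∀ x → iter F A T x ≈ᴹ x
        iter-T = equivariant-unique (iter-equivariant T) (iter-equivariant 0) A^T

        iter-multiple : ∀ k x → iter F A (k ℕ.* T) x ≈ᴹ x
        iter-multiple k x = ≈ᴹ-trans (≈ᴹ-reflexive (iter-* A T k x)) (iter-fixed (iter-linear A-lin T) (iter-T x) k)

        powers-of-power : ∀ j k x → iter F (iter F A j) (k ℕ.* T) x ≈ᴹ x
        powers-of-power j k x = begin
          iter F (iter F A j) (k ℕ.* T) x ≡⟨ iter-* A j (k ℕ.* T) x ⟨
          iter F A (k ℕ.* T ℕ.* j) x      ≡⟨ ≡.cong (λ m → iter F A m x) (ℕₚ.*-comm (k ℕ.* T) j) ⟩
          iter F A (j ℕ.* (k ℕ.* T)) x    ≡⟨ ≡.cong (λ m → iter F A m x) (ℕₚ.*-assoc j k T) ⟨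
          iter F A (j ℕ.* k ℕ.* T) x      ≈⟨ iter-multiple (j ℕ.* k) x ⟩
          x                               ∎

        -- Applying the power T - j turns the equation into A^(T-j+i) x = x, with no inverse of `A`
        -- involved. The exponent lies strictly between 0 and T. If x were nonzero, the absence of
        -- zero divisors would carry this equation over to `1ᴹ`, against the minimality of T.
        powers-separated : ∀ {i j x} → i < j → j < T → iter F A i x ≈ᴹ iter F A j x → x ≈ᴹ 0ᴹ
        powers-separated {i} {j} {x} i<j j<T eq with ≈0? x
        ... | yes x≈0 = x≈0
        ... | no x≉0  = contradiction (difference-zero⁻¹ _ _ (no-zero-divisors fixed-eq x≉0 (difference-zero _ _ fixed)))
                                      (minimal (k ℕ.+ i) 1≤k+i k+i<T)
          where
          k = T ∸ j
          fixed-eq = ⊖-equivariant (iter-equivariant (k ℕ.+ i)) (iter-equivariant 0)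
          k+j≡T : k ℕ.+ j ≡ T
          k+j≡T = ℕₚ.m∸n+n≡m (ℕₚ.<⇒≤ j<T)
          1≤k+i : 1 ≤ k ℕ.+ i
          1≤k+i = ℕₚ.≤-trans (ℕₚ.m<n⇒0<n∸m j<T) (ℕₚ.m≤m+n k i)
          k+i<T : k ℕ.+ i < T
          k+i<T = ≡.subst (k ℕ.+ i <_) k+j≡T (ℕₚ.+-monoʳ-< k i<j)
          fixed : iter F A (k ℕ.+ i) x ≈ᴹ x
          fixed = begin
            iter F A (k ℕ.+ i) x         ≡⟨ iter-+ A k i x ⟩
            iter F A k (iter F A i x)    ≈⟨ cong (iter-linear A-lin k) eq ⟩
            iter F A k (iter F A j x)    ≡⟨ iter-+ A k j x ⟨
            iter F A (k ℕ.+ j) x         ≡⟨ ≡.cong (λ m → iter F A m x) k+j≡T ⟩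
            iter F A T x                 ≈⟨ iter-T x ⟩
            x                            ∎

        module _ (1≉0 : ¬ 1ᴹ ≈ᴹ 0ᴹ) where

          -- If h g vanishes on the T powers of A while h has degree < T, some power is a root of g.
          root-among-powers :
            ∀ {m} (g : Vec Carrier m) (h : Vec Carrier T) → ¬ h ≐ 0ₚ →
            (∀ j → eval (iter F A j) h (eval (iter F A j) g 1ᴹ) ≈ᴹ 0ᴹ) →
            ∃[ j ] eval (iter F A j) g 1ᴹ ≈ᴹ 0ᴹ
          root-among-powers g h h≉0 hg≈0
            with ℕₚ.anyUpTo? (λ j → ≈0? (eval (iter F A j) g 1ᴹ)) T
          ... | yes (j , _ , root) = j , root
          ... | no no-root = contradiction h≐0 h≉0
            where
            h-roots : ∀ {j} → j < T → eval (iter F A j) h 1ᴹ ≈ᴹ 0ᴹ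
            h-roots {j} j<T = no-zero-divisors (eval-equivariant (iter-equivariant j) h)
                                (λ root → no-root (j , j<T , root)) (hg≈0 j)

            h≐0 : h ≐ 0ₚ
            -- The scalars of `h` are first read as the vectors a `1ᴹ`, the form that
            -- `too-many-roots` expects; torsion-freeness then recovers the scalars.
            h≐0 i = trans (*ₗ-torsion-free 1≉0 (≈ᴹ-trans (≈ᴹ-reflexive (≡.sym (Vecₚ.lookup-map i (_*ₗ 1ᴹ) h)))
              (too-many-roots T (iter F A) (iter-linear A-lin) iter-commute powers-separated
                 (map (_*ₗ 1ᴹ) h) ℕₚ.≤-refl h-roots i))) (reflexive (≡.sym (Vecₚ.lookup-replicate i 0#)))

  -- The quotient ring F[x]/(f)

  rawVectors : ℕ → RawLeftModule Carrier c ℓ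
  rawVectors n = record
    { Carrierᴹ = Vec Carrier n
    ; _≈ᴹ_     = _≐_
    ; _+ᴹ_     = _⊕_ F
    ; _*ₗ_     = _·_ F
    ; 0ᴹ       = 0ₚ
    ; -ᴹ_      = map (-_)
    }

  Vectors : ℕ → LeftModule ring c ℓ
  Vectors n = record
    { isLeftModule = LeftModuleMonomorphism.isLeftModule
        {M = rawVectors n} {N = LeftModule.rawLeftModule (Functions (Fin n))} {⟦_⟧ = lookup}
        lookup-monomorphism isRing (LeftModule.isLeftModule (Functions (Fin n)))
    }
    where
    lookup-monomorphism : IsLeftModuleMonomorphism (rawVectors n) (LeftModule.rawLeftModule (Functions (Fin n))) lookup
    lookup-monomorphism = record
      { isLeftModuleHomomorphism = record
        { +ᴹ-isGroupHomomorphism = record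
          { isMonoidHomomorphism = record
            { isMagmaHomomorphism = record
              { isRelHomomorphism = record { cong = λ u≐v → u≐v }
              ; homo = λ u v i → reflexive (Vecₚ.lookup-zipWith _+_ i u v)
              }
            ; ε-homo = λ i → reflexive (Vecₚ.lookup-replicate i 0#)
            }
          ; ⁻¹-homo = λ u i → reflexive (Vecₚ.lookup-map i (-_) u)
          }
        ; *ₗ-homo = λ a u i → reflexive (Vecₚ.lookup-map i (a *_) u)
        }
      ; injective = λ u≐v → u≐v
      }

  _≐?_ : ∀ {n} (u v : Vec Carrier n) → Dec (u ≐ v)
  u ≐? v = Finₚ.all? λ i → lookup u i ≈? lookup v i

  lookup-last : ∀ {m} (u : Vec Carrier (suc m)) → lookup u (fromℕ m) ≡ last u
  lookup-last (a ∷ [])    = ≡.refl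
  lookup-last (a ∷ b ∷ u) = lookup-last (b ∷ u)

  last-cong : ∀ {m} {u v : Vec Carrier (suc m)} → u ≐ v → last u ≈ last v
  last-cong {m} {u} {v} u≐v =
    ≡.subst₂ _≈_ (lookup-last u) (lookup-last v) (u≐v (fromℕ m))

  module QuotientRing {d} (f : Vec Carrier (suc (suc d))) (f-irr : Irreducible F f) where

    f-deg : HasDegree F f
    f-deg = proj₁ (proj₂ f-irr)

    open LeftModule (Vectors (suc d)) using (_+ᴹ_; _*ₗ_)
    open LinearOperators (Vectors (suc d)) using (IsLinear; eval)
    open Relation.Binary.Reasoning.Setoid setoid

    private
      1ᵥ : Vec Carrier (suc d)
      1ᵥ = oneV F

      reduction : Fin (suc d) → Carrier
      reduction i = last f ⁻¹ * lookup (init f) i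

    lookup-η : ∀ u i → lookup (η F f u) i ≡ lookup (0# ∷ init u) i + - (last u * reduction i)
    lookup-η u i = Vecₚ.lookup-zipWith (λ t a → t + - (last u * (last f ⁻¹ * a))) i (0# ∷ init u) (init f)

    η-linear : IsLinear (η F f)
    η-linear = record { cong = λ {u} {v} → η-cong u v ; +-homo = η-+ ; *-homo = η-* }
      where
      η-cong : ∀ u v → u ≐ v → η F f u ≐ η F f v
      η-cong u v u≐v i = begin
        lookup (η F f u) i                                   ≡⟨ lookup-η u i ⟩
        lookup (0# ∷ init u) i + - (last u * reduction i)    ≈⟨ +-cong (low i) (-‿cong (*-congʳ (last-cong {u = u} {v} u≐v))) ⟩
        lookup (0# ∷ init v) i + - (last v * reduction i)    ≡⟨ lookup-η v i ⟨
        lookup (η F f v) i                                   ∎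
        where
        low : ∀ i → lookup (0# ∷ init u) i ≈ lookup (0# ∷ init v) i
        low zero    = refl
        low (suc i) = ≡.subst₂ _≈_ (≡.sym (lookup-init u i)) (≡.sym (lookup-init v i)) (u≐v (inject₁ i))

      η-+ : ∀ u v → η F f (u +ᴹ v) ≐ (η F f u +ᴹ η F f v)
      η-+ u v i = begin
        lookup (η F f (u +ᴹ v)) i
          ≡⟨ lookup-η (u +ᴹ v) i ⟩
        lookup (0# ∷ init (u +ᴹ v)) i + - (last (u +ᴹ v) * r)
          ≈⟨ +-cong (low i) (-‿cong (*-congʳ (reflexive (last-zipWith _+_ u v)))) ⟩
        (lookup (0# ∷ init u) i + lookup (0# ∷ init v) i) + - ((last u + last v) * r)
          ≈⟨ +-congˡ (trans (-‿cong (distribʳ r _ _)) (sym (-‿+-comm _ _))) ⟩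
        (lookup (0# ∷ init u) i + lookup (0# ∷ init v) i) + (- (last u * r) + - (last v * r))
          ≈⟨ +-interchange _ _ _ _ ⟩
        (lookup (0# ∷ init u) i + - (last u * r)) + (lookup (0# ∷ init v) i + - (last v * r))
          ≡⟨ ≡.cong₂ _+_ (lookup-η u i) (lookup-η v i) ⟨
        lookup (η F f u) i + lookup (η F f v) i
          ≡⟨ Vecₚ.lookup-zipWith _+_ i (η F f u) (η F f v) ⟨
        lookup (η F f u +ᴹ η F f v) i ∎
        where
        r = reduction i
        low : ∀ i → lookup (0# ∷ init (u +ᴹ v)) i ≈ lookup (0# ∷ init u) i + lookup (0# ∷ init v) i
        low zero    = sym (+-identityˡ 0#)
        low (suc i) rewrite init-zipWith _+_ u v = reflexive (Vecₚ.lookup-zipWith _+_ i (init u) (init v))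

      η-* : ∀ s u → η F f (s *ₗ u) ≐ (s *ₗ η F f u)
      η-* s u i = begin
        lookup (η F f (s *ₗ u)) i
          ≡⟨ lookup-η (s *ₗ u) i ⟩
        lookup (0# ∷ init (s *ₗ u)) i + - (last (s *ₗ u) * r)
          ≈⟨ +-cong (low i) (-‿cong (trans (*-congʳ (reflexive (last-map (s *_) u))) (*-assoc s _ r))) ⟩
        s * lookup (0# ∷ init u) i + - (s * (last u * r))
          ≈⟨ +-congˡ (-‿distribʳ-* s _) ⟩
        s * lookup (0# ∷ init u) i + s * - (last u * r)
          ≈⟨ distribˡ s _ _ ⟨
        s * (lookup (0# ∷ init u) i + - (last u * r))
          ≡⟨ ≡.cong (s *_) (lookup-η u i) ⟨
        s * lookup (η F f u) i
          ≡⟨ Vecₚ.lookup-map i (s *_) (η F f u) ⟨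
        lookup (s *ₗ η F f u) i ∎
        where
        r = reduction i
        low : ∀ i → lookup (0# ∷ init (s *ₗ u)) i ≈ s * lookup (0# ∷ init u) i
        low zero    = sym (zeroʳ s)
        low (suc i) rewrite init-map (s *_) u = reflexive (Vecₚ.lookup-map i (s *_) (init u))

    lookup-eval-∷ : ∀ {m} a (p : Vec Carrier m) i → lookup (eval (η F f) (a ∷ p) 1ᵥ) i ≈
                    a * lookup 1ᵥ i + (lookup (0# ∷ init (eval (η F f) p 1ᵥ)) i
                                       + - (last (eval (η F f) p 1ᵥ) * reduction i))
    lookup-eval-∷ a p i = begin
      lookup (a *ₗ 1ᵥ +ᴹ η F f w) i                 ≡⟨ Vecₚ.lookup-zipWith _+_ i (a *ₗ 1ᵥ) (η F f w) ⟩
      lookup (a *ₗ 1ᵥ) i + lookup (η F f w) i       ≡⟨ ≡.cong₂ _+_ (Vecₚ.lookup-map i (a *_) 1ᵥ) (lookup-η w i) ⟩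
      a * lookup 1ᵥ i + (lookup (0# ∷ init w) i + - (last w * reduction i)) ∎
      where w = eval (η F f) p 1ᵥ

    lookup-1ᵥ-suc : ∀ i → lookup 1ᵥ (suc i) ≡ 0#
    lookup-1ᵥ-suc i = Vecₚ.lookup-replicate i 0#

    -- With at most d + 1 coefficients nothing is ever reduced: the value of the tail has last entry
    -- 0, so `η` merely shifts it.
    lookup-eval : ∀ {m} (p : Vec Carrier m) → m ≤ suc d → ∀ i →
                  lookup (eval (η F f) p 1ᵥ) i ≈ coeff F p (toℕ i)
    lookup-eval []      _         i = reflexive (Vecₚ.lookup-replicate i 0#)
    lookup-eval (a ∷ p) (s≤s m≤d) i = trans (lookup-eval-∷ a p i) (trans (+-congˡ (no-reduction i)) (entry i))
      where
      w = eval (η F f) p 1ᵥ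
      ih = lookup-eval p (ℕₚ.m≤n⇒m≤1+n m≤d)

      last-w : last w ≈ 0#
      last-w = begin
        last w                          ≡⟨ lookup-last w ⟨
        lookup w (fromℕ d)              ≈⟨ ih (fromℕ d) ⟩
        coeff F p (toℕ (fromℕ d))       ≡⟨ ≡.cong (coeff F p) (Finₚ.toℕ-fromℕ d) ⟩
        coeff F p d                     ≈⟨ coeff-beyond p m≤d ⟩
        0#                              ∎

      no-reduction : ∀ i → lookup (0# ∷ init w) i + - (last w * reduction i) ≈ lookup (0# ∷ init w) i
      no-reduction i = begin
        lookup (0# ∷ init w) i + - (last w * reduction i)   ≈⟨ +-congˡ (-‿cong (trans (*-congʳ last-w) (zeroˡ _))) ⟩
        lookup (0# ∷ init w) i + - 0#                       ≈⟨ +-congˡ -0#≈0# ⟩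
        lookup (0# ∷ init w) i + 0#                         ≈⟨ +-identityʳ _ ⟩
        lookup (0# ∷ init w) i                              ∎

      entry : ∀ i → a * lookup 1ᵥ i + lookup (0# ∷ init w) i ≈ coeff F (a ∷ p) (toℕ i)
      entry zero    = trans (+-identityʳ _) (*-identityʳ a)
      entry (suc i) = begin
        a * lookup 1ᵥ (suc i) + lookup (init w) i   ≈⟨ +-congʳ (trans (*-congˡ (reflexive (lookup-1ᵥ-suc i))) (zeroʳ a)) ⟩
        0# + lookup (init w) i                      ≈⟨ +-identityˡ _ ⟩
        lookup (init w) i                           ≡⟨ lookup-init w i ⟩
        lookup w (inject₁ i)                        ≈⟨ ih (inject₁ i) ⟩
        coeff F p (toℕ (inject₁ i))                 ≡⟨ ≡.cong (coeff F p) (Finₚ.toℕ-inject₁ i) ⟩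
        coeff F p (toℕ i)                           ∎

    eval-self : ∀ u → eval (η F f) u 1ᵥ ≐ u
    eval-self u i = trans (lookup-eval u ℕₚ.≤-refl i) (reflexive (coeff-toℕ u i))

    -- Only the outermost Horner step reduces. The tail of `f` is short enough to evaluate to
    -- itself, and its last entry is the leading coefficient of `f`, so `η` subtracts exactly
    -- `init f`, which is what the shifted tail and the constant term add up to.
    eval-f : eval (η F f) f 1ᵥ ≐ 0ₚ
    eval-f i = trans (vanish f ≡.refl i) (reflexive (≡.sym (Vecₚ.lookup-replicate i 0#)))
      where
      -- The equation with `g` allows the module parameter `f` to be split into head and tail.
      vanish : ∀ g → g ≡ f → ∀ i → lookup (eval (η F f) g 1ᵥ) i ≈ 0#
      vanish (a ∷ p@(b ∷ p′)) ≡.refl i = begin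
        lookup (eval (η F f) (a ∷ p) 1ᵥ) i
          ≈⟨ lookup-eval-∷ a p i ⟩
        a * lookup 1ᵥ i + (lookup (0# ∷ init w) i + - (last w * (last p ⁻¹ * e)))
          ≈⟨ +-congˡ (+-congˡ (-‿cong (trans (*-congʳ (last-cong {u = w} {p} (eval-self p))) cancel))) ⟩
        a * lookup 1ᵥ i + (lookup (0# ∷ init w) i + - e)
          ≈⟨ +-assoc _ _ _ ⟨
        (a * lookup 1ᵥ i + lookup (0# ∷ init w) i) + - e
          ≈⟨ +-congʳ (low i) ⟩
        e + - e
          ≈⟨ -‿inverseʳ e ⟩
        0# ∎
        where
        w = eval (η F f) p 1ᵥ
        e = lookup (init f) i

        cancel : last p * (last p ⁻¹ * e) ≈ e
        cancel = trans (sym (*-assoc _ _ _)) (trans (*-congʳ (⁻¹-inverse (last p) f-deg)) (*-identityˡ e))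

        low : ∀ i → a * lookup 1ᵥ i + lookup (0# ∷ init w) i ≈ lookup (init f) i
        low zero    = trans (+-identityʳ _) (*-identityʳ a)
        low (suc i) = begin
          a * lookup 1ᵥ (suc i) + lookup (init w) i   ≈⟨ +-congʳ (trans (*-congˡ (reflexive (lookup-1ᵥ-suc i))) (zeroʳ a)) ⟩
          0# + lookup (init w) i                      ≈⟨ +-identityˡ _ ⟩
          lookup (init w) i                           ≡⟨ lookup-init w i ⟩
          lookup w (inject₁ i)                        ≈⟨ eval-self p (inject₁ i) ⟩
          lookup p (inject₁ i)                        ≡⟨ lookup-init p i ⟨
          lookup (init p) i                           ∎

    1ᵥ≉0 : ¬ 1ᵥ ≐ 0ₚ
    1ᵥ≉0 1≐0 = 1≉0 (1≐0 zero)

    module _ {T} (ord : HasOrder F f T) where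

      private
        module C = CyclicModule (Vectors (suc d)) η-linear 1ᵥ (_≐? 0ₚ) (λ u → u) eval-self {f} f-irr eval-f
        1≤T = proj₁ ord
        η^T≐1 = proj₁ (proj₂ ord)
        minimal = proj₂ (proj₂ ord)

      η-iter-multiple : ∀ k u → iter F (η F f) (k ℕ.* T) u ≐ u
      η-iter-multiple = C.iter-multiple 1≤T η^T≐1 minimal

      η-powers-of-power : ∀ j k u → iter F (iter F (η F f) j) (k ℕ.* T) u ≐ u
      η-powers-of-power = C.powers-of-power 1≤T η^T≐1 minimal

      η-root-among-powers :
        ∀ {m} (g : Vec Carrier m) (h : Vec Carrier T) → ¬ h ≐ 0ₚ →
        (∀ j → eval (iter F (η F f) j) h (eval (iter F (η F f) j) g 1ᵥ) ≐ 0ₚ) →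
        ∃[ j ] eval (iter F (η F f) j) g 1ᵥ ≐ 0ₚ
      η-root-among-powers = C.root-among-powers 1≤T η^T≐1 minimal 1ᵥ≉0

  -- A root of f₁ among the powers of ω₂, and the isomorphism it defines

  monomial : ∀ t → Vec Carrier (suc t)
  monomial zero    = 1# ∷ []
  monomial (suc t) = 0# ∷ monomial t

  X^1+_⊖1 : ∀ t → Vec Carrier (suc (suc t))
  X^1+ t ⊖1 = - 1# ∷ monomial t

  module _ (M : LeftModule ring c ℓ) where

    open LeftModule M
    open LinearOperators M
    open Relation.Binary.Reasoning.Setoid ≈ᴹ-setoid

    eval-monomial : ∀ {A} → IsLinear A → ∀ t v → eval A (monomial t) v ≈ᴹ iter F A t v
    eval-monomial A-lin zero    v = eval-oneV A-lin 0 v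
    eval-monomial {A} A-lin (suc t) v = begin
      0# *ₗ v +ᴹ A (eval A (monomial t) v)   ≈⟨ +ᴹ-cong (*ₗ-zeroˡ v) (cong A-lin (eval-monomial A-lin t v)) ⟩
      0ᴹ +ᴹ A (iter F A t v)                 ≈⟨ +ᴹ-identityˡ _ ⟩
      A (iter F A t v)                       ∎

    eval-X^1+⊖1 : ∀ {A} → IsLinear A → ∀ t v → iter F A (suc t) v ≈ᴹ v → eval A (X^1+ t ⊖1) v ≈ᴹ 0ᴹ
    eval-X^1+⊖1 {A} A-lin t v A^T = begin
      (- 1#) *ₗ v +ᴹ A (eval A (monomial t) v)   ≈⟨ +ᴹ-congˡ (cong A-lin (eval-monomial A-lin t v)) ⟩
      (- 1#) *ₗ v +ᴹ A (iter F A t v)            ≈⟨ +ᴹ-congˡ (≈ᴹ-trans A^T (≈ᴹ-sym (*ₗ-identityˡ v))) ⟩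
      (- 1#) *ₗ v +ᴹ 1# *ₗ v                     ≈⟨ *ₗ-distribʳ v (- 1#) 1# ⟨
      (- 1# + 1#) *ₗ v                           ≈⟨ *ₗ-congʳ (-‿inverseˡ 1#) ⟩
      0# *ₗ v                                    ≈⟨ *ₗ-zeroˡ v ⟩
      0ᴹ                                         ∎

  module _ {d} (f : Vec Carrier (suc (suc d))) (f-irr : Irreducible F f)
           {t} (ord : HasOrder F f (suc t)) where

    open LeftModule (Vectors (suc d))
    open LinearOperators (Vectors (suc d))

    private
      f-deg : HasDegree F f
      f-deg = proj₁ (proj₂ f-irr)

      η-linear : IsLinear (η F f)
      η-linear = QuotientRing.η-linear f f-irr

    -- The dividend has T + 1 coefficients, where T = t + 1, so the quotient has T of them: the
    -- bound deg h < T that the root count requires is carried by the type.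
    cofactor : Vec Carrier (suc t)
    cofactor = quotient f f-deg (X^1+ t ⊖1)

    -- Both `f` and x^T - 1 annihilate 1 in F[x]/(f), hence so does the remainder; being reduced
    -- already, it is its own class.
    remainder-zero : remainder f f-deg (X^1+ t ⊖1) ≐ 0ₚ
    remainder-zero = begin
      r                            ≈⟨ QuotientRing.eval-self f f-irr r ⟨
      eval (η F f) r (oneV F)
        ≈⟨ remainder-annihilates f f-deg (Vectors (suc d)) η-linear (X^1+ t ⊖1) {oneV F}
             (QuotientRing.eval-f f f-irr)
             (eval-X^1+⊖1 (Vectors (suc d)) η-linear t (oneV F) (proj₁ (proj₂ ord))) ⟩
      0ₚ ∎
      where
      open Relation.Binary.Reasoning.Setoid ≈ᴹ-setoid
      r = remainder f f-deg (X^1+ t ⊖1)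

    module _ (M : LeftModule ring c ℓ) where

      private
        module M = LeftModule M
        module L = LinearOperators M

      -- The generality in the module matters: on sequences this shows that the cofactor is nonzero,
      -- and on F[x]/(f₂) with a power of `η₂` it shows that h f₁ vanishes at the powers of ω₂.
      cofactor-division : ∀ {A} → L.IsLinear A → ∀ v →
                          L.eval A (X^1+ t ⊖1) v M.≈ᴹ L.eval A cofactor (L.eval A f v)
      cofactor-division {A} A-lin v = begin
        L.eval A (X^1+ t ⊖1) v
          ≈⟨ division f f-deg M A-lin (X^1+ t ⊖1) v ⟩
        L.eval A cofactor (L.eval A f v) M.+ᴹ L.eval A (remainder f f-deg (X^1+ t ⊖1)) v
          ≈⟨ M.+ᴹ-congˡ (M.≈ᴹ-trans
               (L.eval-cong A-lin (remainder f f-deg (X^1+ t ⊖1)) 0ₚ remainder-zero M.≈ᴹ-refl)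
               (L.eval-0ₚ A-lin (suc d) v)) ⟩
        L.eval A cofactor (L.eval A f v) M.+ᴹ M.0ᴹ
          ≈⟨ M.+ᴹ-identityʳ _ ⟩
        L.eval A cofactor (L.eval A f v) ∎
        where open Relation.Binary.Reasoning.Setoid M.≈ᴹ-setoid

    -- Otherwise x^T - 1 would be zero, although its constant coefficient is -1.
    cofactor≉0 : ¬ cofactor ≐ 0ₚ
    cofactor≉0 h≐0 = 1≉0 (begin
      1#              ≈⟨ -‿involutive 1# ⟨
      - - 1#          ≈⟨ -‿cong -1≈0 ⟩
      - 0#            ≈⟨ -0#≈0# ⟩
      0#              ∎)
      where
      open Relation.Binary.Reasoning.Setoid setoid
      open Sequences
      module L = LinearOperators (Functions ℕ)
      -1≈0 : - 1# ≈ 0#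
      -1≈0 = begin
        - 1#                                             ≈⟨ eval-δ (X^1+ t ⊖1) 0 ⟨
        L.eval shift (X^1+ t ⊖1) δ 0                     ≈⟨ cofactor-division (Functions ℕ) shift-linear δ 0 ⟩
        L.eval shift cofactor (L.eval shift f δ) 0       ≈⟨ L.eval-cong shift-linear cofactor 0ₚ h≐0 (λ _ → refl) 0 ⟩
        L.eval shift (0ₚ {suc t}) (L.eval shift f δ) 0   ≈⟨ L.eval-0ₚ shift-linear (suc t) (L.eval shift f δ) 0 ⟩
        0#                                               ∎

  module _ {d} (f₁ f₂ : Vec Carrier (suc (suc d)))
           (f₁-irr : Irreducible F f₁) (f₂-irr : Irreducible F f₂)
           {t} (ord₁ : HasOrder F f₁ (suc t)) (ord₂ : HasOrder F f₂ (suc t)) where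

    open LeftModule (Vectors (suc d))
    open LinearOperators (Vectors (suc d))
    open Relation.Binary.Reasoning.Setoid ≈ᴹ-setoid

    private
      V = Vec Carrier (suc d)

      T : ℕ
      T = suc t

      η₁ η₂ : V → V
      η₁ = η F f₁
      η₂ = η F f₂

      1ᵥ : V
      1ᵥ = oneV F

      η-linear : IsLinear η₂
      η-linear = QuotientRing.η-linear f₂ f₂-irr

      η₂-iter-multiple : ∀ k x → iter F η₂ (k ℕ.* T) x ≐ x
      η₂-iter-multiple = QuotientRing.η-iter-multiple f₂ f₂-irr ord₂

    common-root : ∃[ j ] eval (iter F η₂ j) f₁ 1ᵥ ≐ 0ₚ
    common-root = QuotientRing.η-root-among-powers f₂ f₂-irr ord₂
             f₁ (cofactor f₁ f₁-irr ord₁) (cofactor≉0 f₁ f₁-irr ord₁) λ j → begin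
      eval (iter F η₂ j) (cofactor f₁ f₁-irr ord₁) (eval (iter F η₂ j) f₁ 1ᵥ)
        ≈⟨ cofactor-division f₁ f₁-irr ord₁ (Vectors (suc d)) (iter-linear η-linear j) 1ᵥ ⟨
      eval (iter F η₂ j) (X^1+ t ⊖1) 1ᵥ
        ≈⟨ eval-X^1+⊖1 (Vectors (suc d)) (iter-linear η-linear j) t 1ᵥ (power-T j) ⟩
      0ₚ ∎
      where
      power-T : ∀ j → iter F (iter F η₂ j) T 1ᵥ ≈ᴹ 1ᵥ
      power-T j = ≡.subst (λ m → iter F (iter F η₂ j) m 1ᵥ ≈ᴹ 1ᵥ) (ℕₚ.*-identityˡ T)
        (QuotientRing.η-powers-of-power f₂ f₂-irr ord₂ j 1 1ᵥ)

    module Embedding (j : ℕ) (root : eval (iter F η₂ j) f₁ 1ᵥ ≐ 0ₚ) where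

      B : V → V
      B = iter F η₂ j

      B-linear : IsLinear B
      B-linear = iter-linear η-linear j

      φ : V → V
      φ u = eval B u 1ᵥ

      φ-cong : ∀ u v → u ≐ v → φ u ≐ φ v
      φ-cong u v u≐v = eval-cong B-linear u v {1ᵥ} {1ᵥ} u≐v (λ _ → refl)

      φ-1 : φ 1ᵥ ≐ 1ᵥ
      φ-1 = eval-oneV B-linear d 1ᵥ

      -- By `eval-η` the two sides differ by a scalar multiple of f₁(B) applied to 1, which is zero
      -- because ω₂^j is a root of `f₁`.
      φ-η : ∀ u → φ (η₁ u) ≐ B (φ u)
      φ-η u = begin
        φ (η₁ u)                               ≈⟨ +ᴹ-identityʳ (φ (η₁ u)) ⟨
        φ (η₁ u) +ᴹ 0ₚ                         ≈⟨ +ᴹ-congˡ {φ (η₁ u)} {s *ₗ 0ₚ} {0ₚ} (*ₗ-zeroʳ s) ⟨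
        φ (η₁ u) +ᴹ s *ₗ 0ₚ
          ≈⟨ +ᴹ-congˡ {φ (η₁ u)} {s *ₗ eval B f₁ 1ᵥ} {s *ₗ 0ₚ} (*ₗ-congˡ {s} {eval B f₁ 1ᵥ} {0ₚ} root) ⟨
        φ (η₁ u) +ᴹ s *ₗ eval B f₁ 1ᵥ          ≈⟨ eval-η B-linear f₁ (proj₁ (proj₂ f₁-irr)) u 1ᵥ ⟨
        B (φ u)                                ∎
        where s = last u * last f₁ ⁻¹

      φ-iter : ∀ k u → φ (iter F η₁ k u) ≐ iter F B k (φ u)
      φ-iter zero    u = λ _ → refl
      φ-iter (suc k) u = begin
        φ (η₁ (iter F η₁ k u))    ≈⟨ φ-η (iter F η₁ k u) ⟩
        B (φ (iter F η₁ k u))     ≈⟨ cong B-linear {φ (iter F η₁ k u)} {iter F B k (φ u)} (φ-iter k u) ⟩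
        B (iter F B k (φ u))      ∎

      φ-injective : ∀ u v → φ u ≐ φ v → u ≐ v
      φ-injective u v φu≐φv = difference-zero⁻¹ u v
        (annihilator-trivial {f = f₁} f₁-irr (Vectors (suc d)) B-linear (QuotientRing.1ᵥ≉0 f₂ f₂-irr) root
           (u +ᴹ (- 1#) *ₗ v) ℕₚ.≤-refl (begin
             φ (u +ᴹ (- 1#) *ₗ v)           ≈⟨ eval-⊕ B-linear u ((- 1#) *ₗ v) 1ᵥ ⟩
             φ u +ᴹ φ ((- 1#) *ₗ v)
               ≈⟨ +ᴹ-congˡ {φ u} {φ ((- 1#) *ₗ v)} {(- 1#) *ₗ φ v} (eval-· B-linear (- 1#) v 1ᵥ) ⟩
             φ u +ᴹ (- 1#) *ₗ φ v           ≈⟨ difference-zero (φ u) (φ v) φu≐φv ⟩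
             0ₚ                             ∎))

      -- If e divides both j and T, then B has order at most T / e, hence so has η₁ by injectivity of φ.
      common-divisor≡1 : ∀ {e} → e ∣ j → e ∣ T → e ≡ 1
      common-divisor≡1 {zero}        _             (divides r T≡0)   =
        contradiction (≡.trans T≡0 (ℕₚ.*-zeroʳ r)) λ ()
      common-divisor≡1 {suc zero}    _             _                 = ≡.refl
      common-divisor≡1 {suc (suc e)} (divides k j≡ke) (divides (suc r) T≡re) =
        contradiction (φ-injective (iter F η₁ (suc r) 1ᵥ) 1ᵥ (begin
          φ (iter F η₁ (suc r) 1ᵥ)        ≈⟨ φ-iter (suc r) 1ᵥ ⟩
          iter F B (suc r) (φ 1ᵥ)         ≈⟨ cong (iter-linear B-linear (suc r)) {φ 1ᵥ} {1ᵥ} φ-1 ⟩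
          iter F B (suc r) 1ᵥ             ≡⟨ iter-* η₂ j (suc r) 1ᵥ ⟨
          iter F η₂ (suc r ℕ.* j) 1ᵥ      ≡⟨ ≡.cong (λ i → iter F η₂ i 1ᵥ) rj≡kT ⟩
          iter F η₂ (k ℕ.* T) 1ᵥ          ≈⟨ η₂-iter-multiple k 1ᵥ ⟩
          1ᵥ                              ≈⟨ φ-1 ⟨
          φ 1ᵥ                            ∎))
        (proj₂ (proj₂ ord₁) (suc r) (s≤s z≤n)
          (≡.subst (suc r <_) (≡.sym T≡re) (ℕₚ.m<m*n (suc r) (suc (suc e)) (s≤s (s≤s z≤n)))))
        where
        rj≡kT : suc r ℕ.* j ≡ k ℕ.* T
        rj≡kT = ≡.trans (≡.cong (suc r ℕ.*_) j≡ke)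
          (≡.trans (x∙yz≈y∙xz (suc r) k (suc (suc e))) (≡.cong (k ℕ.*_) (≡.sym T≡re)))

      j-coprime-T : GCD j T 1
      j-coprime-T = ≡.subst (GCD j T) (common-divisor≡1 (gcd[m,n]∣m j T) (gcd[m,n]∣n j T)) (gcd-GCD j T)

      η₂-is-power-of-B : ∃[ m ] ∀ x → iter F B m x ≐ η₂ x
      η₂-is-power-of-B with bézout {j} {T} (s≤s z≤n) j-coprime-T
      ... | m , k , l , eq = m , λ x → begin
        iter F B m x                                         ≡⟨ iter-* η₂ j m x ⟨
        iter F η₂ (m ℕ.* j) x
          -- The additional k T iterations act as the identity and complete the exponent to the left
          -- side of the Bézout identity.
          ≈⟨ cong (iter-linear η-linear (m ℕ.* j)) {iter F η₂ (k ℕ.* T) x} {x} (η₂-iter-multiple k x) ⟨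
        iter F η₂ (m ℕ.* j) (iter F η₂ (k ℕ.* T) x)          ≡⟨ iter-+ η₂ (m ℕ.* j) (k ℕ.* T) x ⟨
        iter F η₂ (m ℕ.* j ℕ.+ k ℕ.* T) x                    ≡⟨ ≡.cong (λ i → iter F η₂ i x) eq ⟩
        η₂ (iter F η₂ (l ℕ.* T) x)
          ≈⟨ cong η-linear {iter F η₂ (l ℕ.* T) x} {x} (η₂-iter-multiple l x) ⟩
        η₂ x                                                 ∎

      -- A preimage is built along Horner's scheme for `w` at `η₂`: since φ turns `η₁` into `B` and
      -- `B` iterated m times is `η₂`, each application of `η₂` lifts to m applications of `η₁`.
      φ-surjective : ∀ w → ∃[ v ] φ v ≐ w
      φ-surjective w with η₂-is-power-of-B
      ... | m , B^m≐η₂ = proj₁ (preimage w) , (begin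
        φ (proj₁ (preimage w))    ≈⟨ proj₂ (preimage w) ⟩
        eval η₂ w 1ᵥ              ≈⟨ QuotientRing.eval-self f₂ f₂-irr w ⟩
        w                         ∎)
        where
        preimage : ∀ {i} (p : Vec Carrier i) → ∃[ v ] φ v ≐ eval η₂ p 1ᵥ
        preimage []      = 0ₚ , eval-0ₚ B-linear (suc d) 1ᵥ
        preimage (a ∷ p) with preimage p
        ... | v , φv≐p = a *ₗ 1ᵥ +ᴹ iter F η₁ m v , (begin
          φ (a *ₗ 1ᵥ +ᴹ iter F η₁ m v)
            ≈⟨ eval-⊕ B-linear (a *ₗ 1ᵥ) (iter F η₁ m v) 1ᵥ ⟩
          φ (a *ₗ 1ᵥ) +ᴹ φ (iter F η₁ m v)
            ≈⟨ +ᴹ-cong {φ (a *ₗ 1ᵥ)} {a *ₗ 1ᵥ} {φ (iter F η₁ m v)} {iter F B m (φ v)} (eval-const B-linear a d 1ᵥ) (φ-iter m v) ⟩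
          a *ₗ 1ᵥ +ᴹ iter F B m (φ v)
            ≈⟨ +ᴹ-congˡ {a *ₗ 1ᵥ} {iter F B m (φ v)} {η₂ (φ v)} (B^m≐η₂ (φ v)) ⟩
          a *ₗ 1ᵥ +ᴹ η₂ (φ v)
            ≈⟨ +ᴹ-congˡ {a *ₗ 1ᵥ} {η₂ (φ v)} {η₂ (eval η₂ p 1ᵥ)} (cong η-linear {φ v} {eval η₂ p 1ᵥ} φv≐p) ⟩
          a *ₗ 1ᵥ +ᴹ η₂ (eval η₂ p 1ᵥ) ∎)

      -- Transport of subspaces and coverings along φ

      iter-η₂-% : ∀ i x → iter F η₂ (i % T) x ≐ iter F η₂ i x
      iter-η₂-% i x = begin
        iter F η₂ (i % T) x
          ≈⟨ cong (iter-linear η-linear (i % T)) {iter F η₂ (i / T ℕ.* T) x} {x} (η₂-iter-multiple (i / T) x) ⟨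
        iter F η₂ (i % T) (iter F η₂ (i / T ℕ.* T) x)
          ≡⟨ iter-+ η₂ (i % T) (i / T ℕ.* T) x ⟨
        iter F η₂ (i % T ℕ.+ i / T ℕ.* T) x
          ≡⟨ ≡.cong (λ k → iter F η₂ k x) (m≡m%n+[m/n]*n i T) ⟨
        iter F η₂ i x ∎

      image : (V → Set (c ⊔ ℓ)) → V → Set (c ⊔ ℓ)
      image U w = ∃[ u ] (U u × φ u ≐ w)

      image-subspace : ∀ U → IsSubspace F U → IsSubspace F (image U)
      image-subspace U (U-resp , U-0 , U-+ , U-·) =
          (λ { w w′ w≐w′ (u , Uu , φu≐w) → u , Uu , λ i → trans (φu≐w i) (w≐w′ i) })
        , (0ₚ , U-0 , eval-0ₚ B-linear (suc d) 1ᵥ)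
        , (λ { w w′ (u , Uu , φu≐w) (u′ , Uu′ , φu′≐w′) → u +ᴹ u′ , U-+ u u′ Uu Uu′ , (begin
            φ (u +ᴹ u′)       ≈⟨ eval-⊕ B-linear u u′ 1ᵥ ⟩
            φ u +ᴹ φ u′       ≈⟨ +ᴹ-cong {φ u} {w} {φ u′} {w′} φu≐w φu′≐w′ ⟩
            w +ᴹ w′           ∎) })
        , (λ { a w (u , Uu , φu≐w) → a *ₗ u , U-· a u Uu , (begin
            φ (a *ₗ u)        ≈⟨ eval-· B-linear a u 1ᵥ ⟩
            a *ₗ φ u          ≈⟨ *ₗ-congˡ {a} {φ u} {w} φu≐w ⟩
            a *ₗ w            ∎) })

      image-proper : ∀ U → IsSubspace F U → IsProper F U → IsProper F (image U)
      image-proper U (U-resp , _) (v , v∉U) =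
        φ v , λ { (u , Uu , φu≐φv) → v∉U (U-resp u v (φ-injective u v φu≐φv) Uu) }

      -- A preimage of w in the i-th translate of `U` puts w in the translate of `image U` by `η₂`
      -- to the power i j, since φ turns `η₁` into the j-th power of `η₂`. Reducing i j modulo T
      -- restores the bound on the exponent.
      image-covering : ∀ U → (∀ v → ∃[ i ] ∃[ u ] (U u × iter F η₁ i u ≐ v)) →
                       ∀ w → ∃[ i ] (i < T × ∃[ u ] (image U u × iter F η₂ i u ≐ w))
      image-covering U cover w with φ-surjective w
      ... | v , φv≐w with cover v
      ... | i , u , Uu , ηⁱu≐v =
        (i ℕ.* j) % T , m%n<n (i ℕ.* j) T , φ u , (u , Uu , λ _ → refl) , (begin
          iter F η₂ ((i ℕ.* j) % T) (φ u)   ≈⟨ iter-η₂-% (i ℕ.* j) (φ u) ⟩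
          iter F η₂ (i ℕ.* j) (φ u)         ≡⟨ iter-* η₂ j i (φ u) ⟩
          iter F B i (φ u)                  ≈⟨ φ-iter i u ⟨
          φ (iter F η₁ i u)                 ≈⟨ φ-cong (iter F η₁ i u) v ηⁱu≐v ⟩
          φ v                               ≈⟨ φv≐w ⟩
          w                                 ∎)

    covering-transfer : AdmitsEtaCovering F f₁ → AdmitsEtaCovering F f₂
    covering-transfer (_ , _ , U , U-subspace , U-proper , cover) with common-root
    ... | j , root =
      T , ord₂ , image U , image-subspace U U-subspace , image-proper U U-subspace U-proper ,
      image-covering U λ v → let (i , _ , u , Uu , eq) = cover v in i , u , Uu , eq
      where open Embedding j root

  admitsEtaCovering-transfer :
    ∀ {n T} (f₁ f₂ : Vec Carrier (suc n)) → Irreducible F f₁ → Irreducible F f₂ →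
    HasOrder F f₁ T → HasOrder F f₂ T → AdmitsEtaCovering F f₁ → AdmitsEtaCovering F f₂
  -- Irreducibility excludes degree 0 and `HasOrder` excludes order 0; what remains is degree d + 1
  -- and order t + 1.
  admitsEtaCovering-transfer {zero} f₁ f₂ (() , _)
  admitsEtaCovering-transfer {suc d} {zero} f₁ f₂ f₁-irr f₂-irr (() , _)
  admitsEtaCovering-transfer {suc d} {suc t} f₁ f₂ f₁-irr f₂-irr ord₁ ord₂ =
    covering-transfer f₁ f₂ f₁-irr f₂-irr ord₁ ord₂

theorem3p7 : ∀ {c ℓ} {q : ℕ} → IsPrimePower q → (F : FiniteField c ℓ q) →
    (n : ℕ) → (f₁ f₂ : Vec (FiniteField.Carrier F) (suc n)) →
    Irreducible F f₁ → Irreducible F f₂ →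
    (T : ℕ) → HasOrder F f₁ T → HasOrder F f₂ T →
    (AdmitsEtaCovering F f₁ ⇔ AdmitsEtaCovering F f₂)
theorem3p7 _ F n f₁ f₂ f₁-irr f₂-irr T ord₁ ord₂ = mk⇔
  (admitsEtaCovering-transfer f₁ f₂ f₁-irr f₂-irr ord₁ ord₂)
  (admitsEtaCovering-transfer f₂ f₁ f₂-irr f₁-irr ord₂ ord₁)
  where open Polynomials F
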